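{- Let $0<\varepsilon\le 1$ be such that $\ln\frac{1+\varepsilon}{\varepsilon}$ is an integer, and let $m=i\cdot\ln\frac{1+\varepsilon}{\varepsilon}$ for some positive integer $i$. Then for the problem $P_m|\varepsilon,\mathrm{online}|\sum p_j(1-U_j)$ (online maximization of total accepted processing time on $m$ parallel identical machines, without preemption, with immediate and irrevocable acceptance and allocation decisions, and slack factor $\varepsilon$) there is a deterministic online algorithm with strict competitive ratio at most $$e\cdot\ln\left(\frac{1+\varepsilon}{\varepsilon}\right)+1.$$
   Context: Problem. There are $m$ parallel identical machines and a finite sequence $\mathcal{J}$ of jobs. Job $J_j$ has release (submission) date $r_j\ge 0$, processing time $p_j>0$ and deadline $d_j$ satisfying the slack condition $d_j-r_j\ge(1+\varepsilon)p_j$. The sequence is ordered so that $J_i$ precedes $J_j$ whenever $r_i<r_j$ (several jobs may have the same release date). Jobs are revealed in sequence order; job $J_j$ becomes known at time $r_j$, and the online algorithm must decide immediately, before seeing any later job of the sequence, whether to accept it ($U_j=0$) or reject it ($U_j=1$). If it accepts the job it must also immediately and irrevocably fix the machine and the starting time of the job. An accepted job is processed without interruption on a single machine, starting no earlier than $r_j$ and completing no later than $d_j$; a machine processes at most one job at a time. The objective is to maximize $\sum_j p_j(1-U_j)$. Let $\mathrm{ALG}(\mathcal{J})$ be the objective value of the online algorithm and $\mathrm{OPT}(\mathcal{J})$ the optimal offline value, i.e. the maximum total processing time of a subset of the jobs of $\mathcal{J}$ that has a non-preemptive schedule on $m$ machines in which every job of the subset is processed between its release date and its deadline. The algorithm has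 strict competitive ratio (at most) $c$ if $\mathrm{OPT}(\mathcal{J})\le c\cdot\mathrm{ALG}(\mathcal{J})$ for every job sequence $\mathcal{J}$ satisfying the slack condition. Here $e$ is Euler's number. -}

module Defs where

open import Algebra.Bundles using (CommutativeRing)
open import Algebra.Structures using (IsCommutativeRing)
import Algebra.Properties.Semiring.Exp as Exp
import Algebra.Properties.Semiring.Mult as Mult
import Algebra.Properties.Semiring.Sum as Sum
open import Axiom.ExcludedMiddle using (ExcludedMiddle)
open import Data.Bool.Base using (true; false; if_then_else_)
open import Data.Fin.Base as Fin using (Fin; toℕ)
open import Data.Fin.Subset using (Subset; inside; outside)
open import Data.Integer.Base using (ℤ; +_; -[1+_])
open import Data.List.Base using (List; length; lookup; take)
open import Data.Maybe.Base using (Maybe; just; nothing; is-just)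
open import Data.Nat.Base as ℕ using (ℕ; suc; _!)
open import Data.Product.Base using (∃; _×_; _,_; proj₁; proj₂)
open import Data.Sum.Base using (_⊎_; inj₁; inj₂)
import Data.Vec.Base as Vec
open Vec using ([]; _∷_)
open import Level using (0ℓ)
open import Relation.Binary.Core using (Rel)
open import Relation.Binary.Structures using (IsTotalOrder)
import Relation.Binary.Construct.NonStrictToStrict as ToStrict
open import Relation.Binary.PropositionalEquality
  using (_≡_; _≢_; refl)
open import Relation.Nullary.Decidable.Core using (yes; no)
open import Relation.Nullary.Negation.Core using (contradiction)

-- The axioms of the real numbers, which determine them up to isomorphism
-- (classically).  Equality is propositional, so that every function on the
-- carrier is a function of real numbers.
record CompleteOrderedField : Set₁ where
  infix  8 _⁻¹
  infixl 7 _*_ _/_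
  infixl 6 _+_ _-_
  infix  4 _≤_
  field
    Carrier           : Set
    _+_ _*_           : Carrier → Carrier → Carrier
    -_                : Carrier → Carrier
    0# 1#             : Carrier
    isCommutativeRing : IsCommutativeRing _≡_ _+_ _*_ -_ 0# 1#
    0≢1               : 0# ≢ 1#
    -- Total for convenience; nothing is assumed about 0# ⁻¹.
    _⁻¹               : Carrier → Carrier
    *-inverseʳ        : ∀ {x} → x ≢ 0# → x * (x ⁻¹) ≡ 1#
    _≤_               : Rel Carrier 0ℓ
    isTotalOrder      : IsTotalOrder _≡_ _≤_
    +-monoˡ-≤         : ∀ {x y} z → x ≤ y → x + z ≤ y + z
    *-nonNeg          : ∀ {x y} → 0# ≤ x → 0# ≤ y → 0# ≤ x * y

  UpperBound : (Carrier → Set) → Carrier → Set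
  UpperBound P b = ∀ {x} → P x → x ≤ b

  field
    complete : (P : Carrier → Set) → ∃ P → ∃ (UpperBound P) →
               ∃ λ s → UpperBound P s × (∀ {b} → UpperBound P b → s ≤ b)

  commutativeRing : CommutativeRing 0ℓ 0ℓ
  commutativeRing = record { isCommutativeRing = isCommutativeRing }

  open ToStrict _≡_ _≤_ public using (_<_)

  _-_ _/_ : Carrier → Carrier → Carrier
  x - y = x + (- y)
  x / y = x * (y ⁻¹)

module Analysis (ℝ : CompleteOrderedField) where
  open CompleteOrderedField ℝ
  open CommutativeRing commutativeRing using (semiring)
  open Exp semiring using (_^_)
  open Mult semiring using () renaming (_×_ to _·_)
  open Sum semiring using (sum)

  fromℕ : ℕ → Carrier
  fromℕ n = n · 1#

  fromℤ : ℤ → Carrier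
  fromℤ (+ n)    = fromℕ n
  fromℤ -[1+ n ] = - fromℕ (suc n)

  ConvergesTo : (ℕ → Carrier) → Carrier → Set
  ConvergesTo s y = ∀ δ → 0# < δ →
    ∃ λ N → ∀ n → N ℕ.≤ n → (y - δ < s n) × (s n < y + δ)

  expPartialSum : Carrier → ℕ → Carrier
  expPartialSum x n =
    sum {n} (λ k → (x ^ toℕ k) / fromℕ (toℕ k !))

  -- y = exp x
  IsExp : Carrier → Carrier → Set
  IsExp x y = ConvergesTo (expPartialSum x) y

  -- x = ln y
  IsLn : Carrier → Carrier → Set
  IsLn y x = IsExp x y

  IsEuler : Carrier → Set
  IsEuler e = IsExp 1# e

module Scheduling (em : ExcludedMiddle 0ℓ) (ℝ : CompleteOrderedField) where
  open CompleteOrderedField ℝ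
  open CommutativeRing commutativeRing using (semiring)
  open Sum semiring using (sum)
  open IsTotalOrder isTotalOrder using (total) renaming
    (refl to ≤-refl; trans to ≤-trans)

  record Job : Set where
    field
      release processing deadline : Carrier

  open Job public

  record IsInstance (ε : Carrier) (J : List Job) : Set where
    field
      release≥0    : ∀ j → 0# ≤ release (lookup J j)
      processing>0 : ∀ j → 0# < processing (lookup J j)
      slack        : ∀ j → (1# + ε) * processing (lookup J j)
                           ≤ deadline (lookup J j) - release (lookup J j)
      ordered      : ∀ i j → release (lookup J i) < release (lookup J j) →
                     i Fin.< j

  -- nothing: rejected; just (k , s): processed on machine k in [s , s + p).
  Schedule : ℕ → List Job → Set
  Schedule m J = Fin (length J) → Maybe (Fin m × Carrier)

  record Feasible {m} (J : List Job) (σ : Schedule m J) : Set where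
    field
      inWindow : ∀ {j k s} → σ j ≡ just (k , s) →
        release (lookup J j) ≤ s ×
        s + processing (lookup J j) ≤ deadline (lookup J j)
      disjoint : ∀ {i j k s t} → i ≢ j →
        σ i ≡ just (k , s) → σ j ≡ just (k , t) →
        s + processing (lookup J i) ≤ t ⊎ t + processing (lookup J j) ≤ s

  accepted : ∀ {m J} → Schedule m J → Subset (length J)
  accepted σ = Vec.tabulate (λ j → is-just (σ j))

  load : (J : List Job) → Subset (length J) → Carrier
  load J S =
    sum (λ j → if Vec.lookup S j then processing (lookup J j) else 0#)

  Schedulable : ℕ → (J : List Job) → Subset (length J) → Set
  Schedulable m J S =
    ∃ λ (σ : Schedule m J) → Feasible J σ × accepted {m} {J} σ ≡ S

  Maximiser : ∀ {n} → (Subset n → Set) → (Subset n → Carrier) → Set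
  Maximiser P f = ∃ λ S → P S × (∀ T → P T → f T ≤ f S)

  maximise : ∀ {n} (P : Subset n → Set) (f : Subset n → Carrier) →
             ∃ P → Maximiser P f
  maximise {0} P f ([] , p) = [] , p , λ { [] _ → ≤-refl }
  maximise {suc n} P f (S , p)
    with em {∃ λ T → P (inside ∷ T)} | em {∃ λ T → P (outside ∷ T)}
  maximise {suc n} P f (inside ∷ S , p) | no ¬i | _ = contradiction (S , p) ¬i
  maximise {suc n} P f (outside ∷ S , p) | _ | no ¬o = contradiction (S , p) ¬o
  maximise {suc n} P f (inside ∷ S , p) | yes i | no ¬o
    with T , q , max ← maximise (λ U → P (inside ∷ U)) (λ U → f (inside ∷ U)) i
    = inside ∷ T , q ,
      λ { (inside ∷ U) r → max U r
        ; (outside ∷ U) r → contradiction (U , r) ¬o }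
  maximise {suc n} P f (outside ∷ S , p) | no ¬i | yes o
    with T , q , max ← maximise (λ U → P (outside ∷ U)) (λ U → f (outside ∷ U)) o
    = outside ∷ T , q ,
      λ { (inside ∷ U) r → contradiction (U , r) ¬i
        ; (outside ∷ U) r → max U r }
  maximise {suc n} P f _ | yes i | yes o
    with T₁ , q₁ , max₁ ← maximise (λ U → P (inside ∷ U)) (λ U → f (inside ∷ U)) i
       | T₂ , q₂ , max₂ ← maximise (λ U → P (outside ∷ U)) (λ U → f (outside ∷ U)) o
    with total (f (inside ∷ T₁)) (f (outside ∷ T₂))
  ... | inj₁ ≤₂ = outside ∷ T₂ , q₂ ,
      λ { (inside ∷ U) r → ≤-trans (max₁ U r) ≤₂ ; (outside ∷ U) r → max₂ U r }
  ... | inj₂ ≤₁ = inside ∷ T₁ , q₁ ,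
      λ { (inside ∷ U) r → max₁ U r ; (outside ∷ U) r → ≤-trans (max₂ U r) ≤₁ }

  optimum : ∀ m J → Maximiser (Schedulable m J) (load J)
  optimum m J = maximise (Schedulable m J) (load J)
    ( accepted {m} {J} (λ _ → nothing)
    , (λ _ → nothing)
    , record { inWindow = λ () ; disjoint = λ _ () }
    , refl )

  OPT : ℕ → List Job → Carrier
  OPT m J = load J (proj₁ (optimum m J))

  -- The first argument lists the jobs already revealed, in sequence order; the
  -- second is the current job.  Past decisions need not be passed, since a
  -- deterministic algorithm can recompute them.
  Policy : ℕ → Set
  Policy m = List Job → Job → Maybe (Fin m × Carrier)

  run : ∀ {m} → Policy m → (J : List Job) → Schedule m J
  run decide J j = decide (take (toℕ j) J) (lookup J j)

  record OnlineAlgorithm (m : ℕ) (ε : Carrier) : Set where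
    field
      decide   : Policy m
      feasible : ∀ J → IsInstance ε J → Feasible J (run decide J)

  ALG : ∀ {m ε} → OnlineAlgorithm m ε → List Job → Carrier
  ALG {m} A J = load J (accepted {m} {J} (run (OnlineAlgorithm.decide A) J))

  StrictlyCompetitive : ∀ {m ε} → OnlineAlgorithm m ε → Carrier → Set
  StrictlyCompetitive {m} {ε} A c =
    ∀ J → IsInstance ε J → OPT m J ≤ c * ALG A J

{-# OPTIONS --safe #-}
module Submission where

-- The algorithm.  Split the m = i n machines, n = ln ((1 + ε) / ε), into i
-- groups of n machines and offer every job to the groups one after the other.
-- A group with backlog U (the total of the times for which its machines are
-- still busy) takes a job with D = d - r if e U ≤ D and some machine can meet
-- the deadline; it uses the most recently used such machine.
--
-- Why a group of n machines suffices.  If the machines of a group are listed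
-- by recency, then e^(j-1) times the residual load of the j-th machine never
-- exceeds the total residual load of the first j machines: a job passing over
-- a machine must be long compared with the backlog up to that machine, and the
-- passing of time preserves the inequality because j ≤ e^(j-1).  So whenever
-- e U ≤ D, the residual load of the last machine is at most e^(-n) D, hence at
-- most ε / (1 + ε) D, hence at most D - p by the slack condition: the job fits.
--
-- Why the ratio is e n + 1.  A group therefore refuses a job only if D ≤ e U.
-- Over a busy period starting at s in which the group accepts total processing
-- time B, the point t + e U stays below s + e B, so the windows of the jobs
-- refused in the period lie in [s , s + e B].  A machine thus processes at most
-- e W units of refused jobs, where W is the total work of the group.  A
-- rejected job is refused by all i groups, so averaging over the groups bounds
-- the rejected part of the optimum by m e ALG / i = e n ALG.

open import Defs
open import Algebra.Bundles using (CommutativeRing)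
import Algebra.Construct.NaturalChoice.Max as Max
import Algebra.Properties.Group as GroupProperties
import Algebra.Properties.Ring as RingProperties
import Algebra.Properties.Semiring.Exp as Exp
import Algebra.Properties.Semiring.Mult as Mult
import Algebra.Properties.Semiring.Mult.TCOptimised as Mult′
import Algebra.Properties.Semiring.Sum as Sum
import Algebra.Solver.Ring
open import Algebra.Solver.Ring.AlmostCommutativeRing using (fromCommutativeRing; _-Raw-AlmostCommutative⟶_)
open import Axiom.ExcludedMiddle using (ExcludedMiddle)
open import Data.Bool.Base using (Bool; true; false; if_then_else_)
open import Data.Fin.Base as Fin using (Fin; zero; suc; toℕ)
import Data.Fin.Properties as Fin
open import Data.Integer.Base as ℤ using (ℤ; +_; -[1+_]; _⊖_)
import Data.Integer.Properties as ℤ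
open import Data.List.Base
  using (List; []; _∷_; _++_; length; lookup; take; foldl; foldr; map; concat; allFin; cartesianProductWith)
open import Data.List.Membership.Propositional.Properties using (∈-allFin)
import Data.List.Properties as List
open import Data.List.Relation.Binary.Permutation.Propositional
  using (_↭_; ↭-refl; ↭-prep; ↭-swap; ↭-trans; ↭-sym; ↭⇒↭ₛ)
import Data.List.Relation.Binary.Permutation.Propositional.Properties as ↭
import Data.List.Relation.Binary.Permutation.Setoid.Properties as ↭ₛ
open import Data.List.Relation.Unary.All as All using (All; []; _∷_)
import Data.List.Relation.Unary.All.Properties as All
open import Data.List.Relation.Unary.AllPairs using (_∷_)
open import Data.List.Relation.Unary.Any as Any using (Any; here; there)
open import Data.List.Relation.Unary.Unique.Propositional using (Unique)
open import Data.List.Relation.Unary.Unique.Propositional.Properties using (cartesianProductWith⁺; allFin⁺)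
open import Data.Maybe.Base using (Maybe; just; nothing; is-just; maybe′)
open import Data.Nat.Base as ℕ using (ℕ; zero; suc; _!)
import Data.Nat.Properties as ℕ
open import Data.Product.Base using (∃; ∃₂; _×_; _,_; proj₁; proj₂)
open import Data.Sum.Base using (_⊎_; inj₁; inj₂)
open import Data.Unit.Base using (⊤; tt)
import Data.Vec.Base as Vec
import Data.Vec.Properties as Vec
open import Function.Base using (_∘_; case_of_)
open import Level using (0ℓ)
open import Relation.Binary.Bundles using (TotalOrder)
open import Relation.Binary.Definitions using (tri<; tri≈; tri>)
import Relation.Binary.Properties.TotalOrder as TotalOrderProperties
open import Relation.Binary.PropositionalEquality
import Relation.Binary.Reasoning.PartialOrder as PosetReasoning
open import Relation.Binary.Structures using (IsTotalOrder)
open import Relation.Nullary.Decidable.Core using (yes; no; does)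
open import Relation.Nullary.Negation.Core using (¬_; contradiction)

-- Arithmetic in an ordered field, with a ring solver over integer coefficients.

module OrderedField (ℝ : CompleteOrderedField) where
  open CompleteOrderedField ℝ public
  open CommutativeRing commutativeRing public
    using (semiring; ring; +-comm; +-assoc; +-identityˡ; +-identityʳ
          ; *-comm; *-assoc; *-identityˡ; *-identityʳ; zeroˡ; zeroʳ; distribˡ; distribʳ; -‿inverseʳ; +-group)
  open Analysis ℝ public using (fromℕ)
  open Exp semiring public using (_^_)
  open IsTotalOrder isTotalOrder public
    using (total) renaming (refl to ≤-refl; reflexive to ≤-reflexive; trans to ≤-trans; antisym to ≤-antisym)

  ≤-totalOrder : TotalOrder 0ℓ 0ℓ 0ℓ
  ≤-totalOrder = record { isTotalOrder = isTotalOrder }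

  open TotalOrderProperties ≤-totalOrder public using (≰⇒≥; ≰⇒>; <⇒≱)
  module ≤-Reasoning = PosetReasoning (TotalOrder.poset ≤-totalOrder)
  open Max ≤-totalOrder public using (_⊔_; x≤x⊔y; x≤y⊔x; x≤y⇒x⊔y≈y; ⊔-lub; x≤y⇒y⊔x≈y)

  -- The ring solver can only cancel terms whose coefficients it can compare,
  -- hence coefficients in ℤ rather than in the field itself.
  module IntegerCoefficients where
    open RingProperties ring using (-0#≈0#; -‿involutive; -‿+-comm; -‿distribˡ-*)
    open Mult′ semiring using (×1-homo-*; ×-homo-+; 1+×) renaming (_×_ to _·_)

    ⟦_⟧ : ℤ → Carrier
    ⟦ + n ⟧      = n · 1#
    ⟦ -[1+ n ] ⟧ = - (suc n · 1#)

    ⊖-homo : ∀ m n → ⟦ m ⊖ n ⟧ ≡ m · 1# + - (n · 1#)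
    ⊖-homo m zero    = sym (trans (cong (λ z → m · 1# + z) -0#≈0#) (+-identityʳ _))
    ⊖-homo zero (suc n) = sym (+-identityˡ _)
    ⊖-homo (suc m) (suc n) = begin
      ⟦ suc m ⊖ suc n ⟧                   ≡⟨ cong ⟦_⟧ (ℤ.[1+m]⊖[1+n]≡m⊖n m n) ⟩
      ⟦ m ⊖ n ⟧                           ≡⟨ ⊖-homo m n ⟩
      a + - b                             ≡⟨ +-identityʳ _ ⟨
      (a + - b) + 0#                      ≡⟨ cong (λ z → (a + - b) + z) (-‿inverseʳ 1#) ⟨
      (a + - b) + (1# + - 1#)             ≡⟨ +-assoc _ _ _ ⟩
      a + (- b + (1# + - 1#))             ≡⟨ cong (λ z → a + z) (+-assoc _ _ _) ⟨
      a + ((- b + 1#) + - 1#)             ≡⟨ cong (λ z → a + (z + - 1#)) (+-comm _ _) ⟩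
      a + ((1# + - b) + - 1#)             ≡⟨ cong (λ z → a + z) (+-assoc _ _ _) ⟩
      a + (1# + (- b + - 1#))             ≡⟨ +-assoc _ _ _ ⟨
      (a + 1#) + (- b + - 1#)             ≡⟨ cong₂ _+_ (+-comm _ _) (trans (+-comm _ _) (-‿+-comm 1# b)) ⟩
      (1# + a) + - (1# + b)               ≡⟨ cong₂ (λ x y → x + - y) (1+× m 1#) (1+× n 1#) ⟨
      suc m · 1# + - (suc n · 1#)         ∎
      where
      open ≡-Reasoning
      a b : Carrier
      a = m · 1#
      b = n · 1#

    -‿homo : ∀ i → ⟦ ℤ.- i ⟧ ≡ - ⟦ i ⟧
    -‿homo (+ zero)  = sym -0#≈0#
    -‿homo (+ suc n) = refl
    -‿homo -[1+ n ]  = sym (-‿involutive _)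

    +-homo : ∀ i j → ⟦ i ℤ.+ j ⟧ ≡ ⟦ i ⟧ + ⟦ j ⟧
    +-homo (+ m)    (+ n)    = ×-homo-+ 1# m n
    +-homo (+ m)    -[1+ n ] = ⊖-homo m (suc n)
    +-homo -[1+ m ] (+ n)    = trans (⊖-homo n (suc m)) (+-comm _ _)
    +-homo -[1+ m ] -[1+ n ] = begin
      ⟦ -[1+ m ] ℤ.+ -[1+ n ] ⟧         ≡⟨ cong ⟦_⟧ (ℤ.neg-distrib-+ (+ suc m) (+ suc n)) ⟨
      ⟦ ℤ.- (+ suc m ℤ.+ + suc n) ⟧     ≡⟨ -‿homo (+ suc m ℤ.+ + suc n) ⟩
      - ⟦ + suc m ℤ.+ + suc n ⟧         ≡⟨ cong -_ (×-homo-+ 1# (suc m) (suc n)) ⟩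
      - (⟦ + suc m ⟧ + ⟦ + suc n ⟧)     ≡⟨ -‿+-comm _ _ ⟨
      ⟦ -[1+ m ] ⟧ + ⟦ -[1+ n ] ⟧       ∎
      where open ≡-Reasoning

    *-homo⁺ : ∀ m j → ⟦ + m ℤ.* j ⟧ ≡ ⟦ + m ⟧ * ⟦ j ⟧
    *-homo⁺ m (+ n) = trans (cong ⟦_⟧ (sym (ℤ.pos-* m n))) (×1-homo-* m n)
    *-homo⁺ m -[1+ n ] = begin
      ⟦ + m ℤ.* -[1+ n ] ⟧           ≡⟨ cong ⟦_⟧ (ℤ.neg-distribʳ-* (+ m) (+ suc n)) ⟨
      ⟦ ℤ.- (+ m ℤ.* + suc n) ⟧      ≡⟨ -‿homo (+ m ℤ.* + suc n) ⟩
      - ⟦ + m ℤ.* + suc n ⟧          ≡⟨ cong -_ (*-homo⁺ m (+ suc n)) ⟩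
      - (⟦ + m ⟧ * ⟦ + suc n ⟧)      ≡⟨ RingProperties.-‿distribʳ-* ring _ _ ⟩
      ⟦ + m ⟧ * ⟦ -[1+ n ] ⟧         ∎
      where open ≡-Reasoning

    *-homo : ∀ i j → ⟦ i ℤ.* j ⟧ ≡ ⟦ i ⟧ * ⟦ j ⟧
    *-homo (+ m) j = *-homo⁺ m j
    *-homo -[1+ m ] j = begin
      ⟦ -[1+ m ] ℤ.* j ⟧             ≡⟨ cong ⟦_⟧ (ℤ.neg-distribˡ-* (+ suc m) j) ⟨
      ⟦ ℤ.- (+ suc m ℤ.* j) ⟧        ≡⟨ -‿homo (+ suc m ℤ.* j) ⟩
      - ⟦ + suc m ℤ.* j ⟧            ≡⟨ cong -_ (*-homo⁺ (suc m) j) ⟩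
      - (⟦ + suc m ⟧ * ⟦ j ⟧)        ≡⟨ -‿distribˡ-* _ _ ⟩
      ⟦ -[1+ m ] ⟧ * ⟦ j ⟧           ∎
      where open ≡-Reasoning

    morphism : ℤ.+-*-rawRing -Raw-AlmostCommutative⟶ fromCommutativeRing commutativeRing
    morphism = record
      { ⟦_⟧ = ⟦_⟧ ; +-homo = +-homo ; *-homo = *-homo ; -‿homo = -‿homo
      ; 0-homo = refl ; 1-homo = refl }

    coefficients≟ : ∀ i j → Maybe (⟦ i ⟧ ≡ ⟦ j ⟧)
    coefficients≟ i j with i ℤ.≟ j
    ... | yes i≡j = just (cong ⟦_⟧ i≡j)
    ... | no _    = nothing

  open Algebra.Solver.Ring ℤ.+-*-rawRing (fromCommutativeRing commutativeRing)
    IntegerCoefficients.morphism IntegerCoefficients.coefficients≟ public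
    using (solve; con; _:+_; _:*_; _:-_; _:=_)

  +-monoʳ-≤ : ∀ {x y} z → x ≤ y → z + x ≤ z + y
  +-monoʳ-≤ z x≤y = subst₂ _≤_ (+-comm _ z) (+-comm _ z) (+-monoˡ-≤ z x≤y)

  +-mono-≤ : ∀ {w x y z} → w ≤ x → y ≤ z → w + y ≤ x + z
  +-mono-≤ w≤x y≤z = ≤-trans (+-monoˡ-≤ _ w≤x) (+-monoʳ-≤ _ y≤z)

  +-nonNeg : ∀ {x y} → 0# ≤ x → 0# ≤ y → 0# ≤ x + y
  +-nonNeg p q = subst (_≤ _) (+-identityˡ 0#) (+-mono-≤ p q)

  gap : ∀ {x y} → x ≤ y → 0# ≤ y - x
  gap {x} x≤y = subst (_≤ _) (-‿inverseʳ x) (+-monoˡ-≤ (- x) x≤y)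

  -- Inequalities are proved by exhibiting the difference of the two sides as a
  -- combination of nonnegative terms, which the ring solver verifies.
  ≤-gap : ∀ {x y z} → 0# ≤ z → y - x ≡ z → x ≤ y
  ≤-gap {x} {y} 0≤z eq =
    subst₂ _≤_ (+-identityˡ x) (solve 2 (λ a b → (a :- b) :+ b := a) refl y x)
      (+-monoˡ-≤ x (subst (0# ≤_) (sym eq) 0≤z))

  -- If 1 ≤ 0, then `0# - 1#` is nonnegative, and its square is 1.
  0≤1 : 0# ≤ 1#
  0≤1 with total 0# 1#
  ... | inj₁ p = p
  ... | inj₂ p = subst (0# ≤_) (solve 0 ((con (+ 0) :- con (+ 1)) :* (con (+ 0) :- con (+ 1)) := con (+ 1)) refl)
                   (*-nonNeg (gap p) (gap p))

  gap-pos : ∀ {x y} → x < y → 0# < y - x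
  gap-pos {x} {y} (x≤y , x≢y) = gap x≤y , λ eq → x≢y (sym (x∙y⁻¹≈ε⇒x≈y y x (sym eq)))
    where open GroupProperties +-group using (x∙y⁻¹≈ε⇒x≈y)

  pos+nonNeg : ∀ {x y} → 0# < x → 0# ≤ y → 0# < x + y
  pos+nonNeg {x} {y} (0≤x , 0≢x) 0≤y = +-nonNeg 0≤x 0≤y , λ eq → 0≢x (≤-antisym 0≤x (≤-gap 0≤y (begin
    0# - x       ≡⟨ cong (_- x) eq ⟩
    x + y - x    ≡⟨ solve 2 (λ x y → x :+ y :- x := y) refl x y ⟩
    y            ∎)))
    where open ≡-Reasoning

  *-monoˡ-≤ : ∀ {x y z} → 0# ≤ z → x ≤ y → z * x ≤ z * y
  *-monoˡ-≤ {x} {y} {z} 0≤z x≤y = ≤-gap (*-nonNeg 0≤z (gap x≤y))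
    (solve 3 (λ x y z → z :* y :- z :* x := z :* (y :- x)) refl x y z)

  -- In the case `y ≤ x`, monotonicity gives the reverse inequality, so the products agree and the
  -- inverse of `z` cancels.
  *-pos-cancelˡ-≤ : ∀ {x y z} → 0# < z → z * x ≤ z * y → x ≤ y
  *-pos-cancelˡ-≤ {x} {y} {z} (0≤z , 0≢z) zx≤zy with total x y
  ... | inj₁ x≤y = x≤y
  ... | inj₂ y≤x = ≤-reflexive (begin
    x                    ≡⟨ unit x ⟨
    z ⁻¹ * (z * x)       ≡⟨ cong (z ⁻¹ *_) (≤-antisym zx≤zy (*-monoˡ-≤ 0≤z y≤x)) ⟩
    z ⁻¹ * (z * y)       ≡⟨ unit y ⟩
    y                    ∎)
    where
    open ≡-Reasoning
    unit : ∀ w → z ⁻¹ * (z * w) ≡ w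
    unit w = begin
      z ⁻¹ * (z * w)     ≡⟨ *-assoc _ _ _ ⟨
      z ⁻¹ * z * w       ≡⟨ cong (_* w) (trans (*-comm _ _) (*-inverseʳ (0≢z ∘ sym))) ⟩
      1# * w             ≡⟨ *-identityˡ w ⟩
      w                  ∎

  *-pos-cancelˡ : ∀ {x y z} → 0# < z → z * x ≡ z * y → x ≡ y
  *-pos-cancelˡ z>0 eq = ≤-antisym (*-pos-cancelˡ-≤ z>0 (≤-reflexive eq)) (*-pos-cancelˡ-≤ z>0 (≤-reflexive (sym eq)))

  *-inverse-pos : ∀ {x} → 0# < x → x * x ⁻¹ ≡ 1#
  *-inverse-pos (_ , 0≢x) = *-inverseʳ (0≢x ∘ sym)

  ⁻¹-nonNeg : ∀ {x} → 0# < x → 0# ≤ x ⁻¹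
  ⁻¹-nonNeg {x} x>0 = *-pos-cancelˡ-≤ x>0
    (subst₂ _≤_ (sym (zeroʳ x)) (sym (*-inverse-pos x>0)) 0≤1)

  ^-nonNeg : ∀ {x} n → 0# ≤ x → 0# ≤ x ^ n
  ^-nonNeg zero    x≥0 = 0≤1
  ^-nonNeg (suc n) x≥0 = *-nonNeg x≥0 (^-nonNeg n x≥0)

  fromℕ-nonNeg : ∀ n → 0# ≤ fromℕ n
  fromℕ-nonNeg zero    = ≤-refl
  fromℕ-nonNeg (suc n) = +-nonNeg 0≤1 (fromℕ-nonNeg n)

  fromℕ-pos : ∀ n → .{{ℕ.NonZero n}} → 0# < fromℕ n
  fromℕ-pos (suc n) = pos+nonNeg (0≤1 , 0≢1) (fromℕ-nonNeg n)

-- The exponential series and the bound of exp n by e^n.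

module Exponential (em : ExcludedMiddle 0ℓ) (ℝ : CompleteOrderedField) where
  open OrderedField ℝ
  open Analysis ℝ using (expPartialSum; ConvergesTo; IsExp; IsEuler)
  open Mult semiring using (×1-homo-*)
  open Sum semiring using (sum; sum-cong-≗; sum-replicate-zero)

  -- Summands are indexed by ℕ so that one sequence can be summed to any length; `expPartialSum x n`
  -- unfolds to `sumBelow n (dividedPower x)`.
  sumBelow : ℕ → (ℕ → Carrier) → Carrier
  sumBelow n f = sum {n} (λ k → f (toℕ k))

  sumBelow-nonNeg : ∀ n {f} → (∀ k → 0# ≤ f k) → 0# ≤ sumBelow n f
  sumBelow-nonNeg zero    f≥0 = ≤-refl
  sumBelow-nonNeg (suc n) f≥0 = +-nonNeg (f≥0 0) (sumBelow-nonNeg n (f≥0 ∘ suc))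

  sumBelow-mono : ∀ m n {f} → (∀ k → 0# ≤ f k) → sumBelow m f ≤ sumBelow (m ℕ.+ n) f
  sumBelow-mono zero    n f≥0 = sumBelow-nonNeg n f≥0
  sumBelow-mono (suc m) n f≥0 = +-monoʳ-≤ _ (sumBelow-mono m n (f≥0 ∘ suc))

  sumBelow-linear : ∀ n c f g → sumBelow n (λ k → c * f k + g k) ≡ c * sumBelow n f + sumBelow n g
  sumBelow-linear zero    c f g = sym (trans (+-identityʳ _) (zeroʳ c))
  sumBelow-linear (suc n) c f g = trans (cong (λ z → c * f 0 + g 0 + z) (sumBelow-linear n c (f ∘ suc) (g ∘ suc)))
    (solve 5 (λ c f₀ g₀ f g → c :* f₀ :+ g₀ :+ (c :* f :+ g) := c :* (f₀ :+ f) :+ (g₀ :+ g)) refl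
      c (f 0) (g 0) (sumBelow n (f ∘ suc)) (sumBelow n (g ∘ suc)))

  -- The Cauchy product: the sum of `A a * B b` over a + b = n, with the term of `A 0` split off to
  -- make the recursion structural.
  convolution : (ℕ → Carrier) → (ℕ → Carrier) → ℕ → Carrier
  convolution A B zero    = A 0 * B 0
  convolution A B (suc n) = A 0 * B (suc n) + convolution (A ∘ suc) B n

  -- Grouped by the index into `A`, the sum consists of terms `A a` times a partial sum of `B`, each
  -- at most `A a * b`.
  sumBelow-convolution : ∀ n A B {b} → (∀ k → 0# ≤ A k) → (∀ k → sumBelow k B ≤ b) →
                         sumBelow n (convolution A B) ≤ sumBelow n A * b
  sumBelow-convolution zero    A B A≥0 B≤b = ≤-reflexive (sym (zeroˡ _))
  sumBelow-convolution (suc n) A B {b} A≥0 B≤b = subst₂ _≤_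
    (sym (trans (cong (λ z → A 0 * B 0 + z) (sumBelow-linear n (A 0) (B ∘ suc) (convolution (A ∘ suc) B)))
      (solve 4 (λ a b s t → a :* b :+ (a :* s :+ t) := a :* (b :+ s) :+ t) refl
        (A 0) (B 0) (sumBelow n (B ∘ suc)) (sumBelow n (convolution (A ∘ suc) B)))))
    (sym (distribʳ _ _ _))
    (+-mono-≤ (*-monoˡ-≤ (A≥0 0) (B≤b (suc n))) (sumBelow-convolution n (A ∘ suc) B (A≥0 ∘ suc) B≤b))

  -- The Euler operator A ↦ (a A_a)_a, with an offset for the induction, is a
  -- derivation for the convolution product.
  convolution-leibniz : ∀ n o {A A′ B B′ : ℕ → Carrier} →
    (∀ a → A′ a ≡ (o + fromℕ a) * A a) → (∀ b → B′ b ≡ fromℕ b * B b) →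
    (o + fromℕ n) * convolution A B n ≡ convolution A′ B n + convolution A B′ n
  convolution-leibniz zero o {A} {A′} {B} {B′} hA hB =
    trans (solve 3 (λ o a b → (o :+ con (+ 0)) :* (a :* b) :=
                      ((o :+ con (+ 0)) :* a) :* b :+ a :* (con (+ 0) :* b)) refl o (A 0) (B 0))
      (sym (cong₂ (λ x y → x * B 0 + A 0 * y) (hA 0) (hB 0)))
  convolution-leibniz (suc n) o {A} {A′} {B} {B′} hA hB = begin
    (o + (1# + fromℕ n)) * (A 0 * B (suc n) + C)
      ≡⟨ solve 5 (λ o n a b c → (o :+ (con (+ 1) :+ n)) :* (a :* b :+ c) :=
            (o :+ con (+ 0)) :* a :* b :+ a :* ((con (+ 1) :+ n) :* b) :+ (o :+ con (+ 1) :+ n) :* c)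
            refl o (fromℕ n) (A 0) (B (suc n)) C ⟩
    (o + 0#) * A 0 * B (suc n) + A 0 * (fromℕ (suc n) * B (suc n)) + (o + 1# + fromℕ n) * C
      ≡⟨ cong₂ _+_ (cong₂ (λ x y → x * B (suc n) + A 0 * y) (sym (hA 0)) (sym (hB (suc n))))
           (convolution-leibniz n (o + 1#)
             (λ a → trans (hA (suc a)) (cong (_* A (suc a)) (sym (+-assoc _ _ _)))) hB) ⟩
    A′ 0 * B (suc n) + A 0 * B′ (suc n) + (convolution (A′ ∘ suc) B n + convolution (A ∘ suc) B′ n)
      ≡⟨ solve 4 (λ a b c d → a :+ b :+ (c :+ d) := a :+ c :+ (b :+ d)) refl _ _ _ _ ⟩
    convolution A′ B (suc n) + convolution A B′ (suc n) ∎
    where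
    open ≡-Reasoning
    C : Carrier
    C = convolution (A ∘ suc) B n

  -- Multiplies the generating function of `A` by `x` times the variable.
  shift : Carrier → (ℕ → Carrier) → ℕ → Carrier
  shift x A zero    = 0#
  shift x A (suc n) = x * A n

  convolution-*ˡ : ∀ n x A B → convolution (λ a → x * A a) B n ≡ x * convolution A B n
  convolution-*ˡ zero    x A B = *-assoc _ _ _
  convolution-*ˡ (suc n) x A B = trans (cong₂ _+_ (*-assoc _ _ _) (convolution-*ˡ n x (A ∘ suc) B))
    (sym (distribˡ _ _ _))

  convolution-shiftˡ : ∀ n x A B → convolution (shift x A) B (suc n) ≡ x * convolution A B n
  convolution-shiftˡ n x A B = trans (cong₂ _+_ (zeroˡ _) (convolution-*ˡ n x A B)) (+-identityˡ _)

  convolution-shiftʳ : ∀ n y A B → convolution A (shift y B) (suc n) ≡ y * convolution A B n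
  convolution-shiftʳ zero    y A B =
    solve 4 (λ a a′ y b → a :* (y :* b) :+ a′ :* con (+ 0) := y :* (a :* b)) refl (A 0) (A 1) y (B 0)
  convolution-shiftʳ (suc n) y A B = trans (cong (λ z → A 0 * (y * B (suc n)) + z) (convolution-shiftʳ n y (A ∘ suc) B))
    (solve 4 (λ a y b c → a :* (y :* b) :+ y :* c := y :* (a :* b :+ c)) refl (A 0) y (B (suc n)) _)

  dividedPower : Carrier → ℕ → Carrier
  dividedPower x n = (x ^ n) / fromℕ (n !)

  !-pos : ∀ n → 0# < fromℕ (n !)
  !-pos n = fromℕ-pos (n !) {{n ℕ.!≢0}}

  dividedPower-nonNeg : ∀ {x} n → 0# ≤ x → 0# ≤ dividedPower x n
  dividedPower-nonNeg n x≥0 = *-nonNeg (^-nonNeg n x≥0) (⁻¹-nonNeg (!-pos n))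

  dividedPower-! : ∀ x n → fromℕ (n !) * dividedPower x n ≡ x ^ n
  dividedPower-! x n = begin
    f * (x ^ n * f ⁻¹)   ≡⟨ solve 3 (λ f y g → f :* (y :* g) := (f :* g) :* y) refl f (x ^ n) (f ⁻¹) ⟩
    (f * f ⁻¹) * x ^ n   ≡⟨ cong (_* (x ^ n)) (*-inverse-pos (!-pos n)) ⟩
    1# * x ^ n           ≡⟨ *-identityˡ _ ⟩
    x ^ n                ∎
    where
    open ≡-Reasoning
    f : Carrier
    f = fromℕ (n !)

  dividedPower-zero : ∀ x → dividedPower x 0 ≡ 1#
  dividedPower-zero x = *-pos-cancelˡ (!-pos 0) (trans (dividedPower-! x 0) (sym (trans (*-identityʳ _) (+-identityʳ 1#))))

  dividedPower-suc : ∀ x n → fromℕ (suc n) * dividedPower x (suc n) ≡ x * dividedPower x n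
  dividedPower-suc x n = *-pos-cancelˡ (!-pos n) (begin
    fromℕ (n !) * (fromℕ (suc n) * d′)
      ≡⟨ solve 3 (λ a b c → a :* (b :* c) := (b :* a) :* c) refl (fromℕ (n !)) (fromℕ (suc n)) d′ ⟩
    fromℕ (suc n) * fromℕ (n !) * d′
      ≡⟨ cong (_* d′) (×1-homo-* (suc n) (n !)) ⟨
    fromℕ (suc n !) * d′
      ≡⟨ dividedPower-! x (suc n) ⟩
    x * x ^ n
      ≡⟨ cong (x *_) (dividedPower-! x n) ⟨
    x * (fromℕ (n !) * dividedPower x n)
      ≡⟨ solve 3 (λ a b c → a :* (b :* c) := b :* (a :* c)) refl x (fromℕ (n !)) (dividedPower x n) ⟩
    fromℕ (n !) * (x * dividedPower x n) ∎)
    where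
    open ≡-Reasoning
    d′ : Carrier
    d′ = dividedPower x (suc n)

  -- The differential equation z f′(z) = x z f(z) of f(z) = exp(x z), coefficient by coefficient.
  dividedPower-shift : ∀ x n → shift x (dividedPower x) n ≡ fromℕ n * dividedPower x n
  dividedPower-shift x zero    = sym (zeroˡ _)
  dividedPower-shift x (suc n) = sym (dividedPower-suc x n)

  -- The binomial theorem divided by n!. Both sides satisfy the same recursion: by the Leibniz rule
  -- and `dividedPower-shift`, n + 1 times the coefficient of the product is x + y times the
  -- preceding one.
  dividedPower-+ : ∀ x y n → dividedPower (x + y) n ≡ convolution (dividedPower x) (dividedPower y) n
  dividedPower-+ x y zero = trans (dividedPower-zero (x + y))
    (sym (trans (cong₂ _*_ (dividedPower-zero x) (dividedPower-zero y)) (*-identityˡ 1#)))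
  dividedPower-+ x y (suc n) = *-pos-cancelˡ (fromℕ-pos (suc n)) (begin
    fromℕ (suc n) * dividedPower (x + y) (suc n)
      ≡⟨ dividedPower-suc (x + y) n ⟩
    (x + y) * dividedPower (x + y) n
      ≡⟨ cong ((x + y) *_) (dividedPower-+ x y n) ⟩
    (x + y) * convolution X Y n
      ≡⟨ distribʳ _ _ _ ⟩
    x * convolution X Y n + y * convolution X Y n
      ≡⟨ cong₂ _+_ (convolution-shiftˡ n x X Y) (convolution-shiftʳ n y X Y) ⟨
    convolution (shift x X) Y (suc n) + convolution X (shift y Y) (suc n)
      ≡⟨ convolution-leibniz (suc n) 0#
           (λ a → trans (dividedPower-shift x a) (cong (_* X a) (sym (+-identityˡ _))))
           (dividedPower-shift y) ⟨
    (0# + fromℕ (suc n)) * convolution X Y (suc n)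
      ≡⟨ cong (_* convolution X Y (suc n)) (+-identityˡ _) ⟩
    fromℕ (suc n) * convolution X Y (suc n) ∎)
    where
    open ≡-Reasoning
    X Y : ℕ → Carrier
    X = dividedPower x
    Y = dividedPower y

  -- Partial sums increase, so one that exceeds `y` keeps all later ones at least as far above `y`.
  sumBelow-≤-limit : ∀ {f y} → (∀ k → 0# ≤ f k) → ConvergesTo (λ n → sumBelow n f) y → ∀ n → sumBelow n f ≤ y
  sumBelow-≤-limit {f} {y} f≥0 lim n with em {sumBelow n f ≤ y}
  ... | yes p = p
  ... | no ¬p with N , close ← lim (sumBelow n f - y)
                     (gap-pos (≰⇒> ¬p)) =
    contradiction
      (subst (_≤ sumBelow (n ℕ.+ N) f) (solve 2 (λ s y → s := y :+ (s :- y)) refl (sumBelow n f) y)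
        (sumBelow-mono n N f≥0))
      (<⇒≱ (proj₂ (close (n ℕ.+ N) (ℕ.m≤n+m N n))))

  limit-≤ : ∀ {s y b} → (∀ n → s n ≤ b) → ConvergesTo s y → y ≤ b
  limit-≤ {s} {y} {b} s≤b lim with em {y ≤ b}
  ... | yes p = p
  -- With this tolerance the lower end of the neighbourhood of `y` is `b` itself.
  ... | no ¬p with N , close ← lim (y - b)
                     (gap-pos (≰⇒> ¬p)) =
    contradiction (subst (s N ≤_) (solve 2 (λ y b → b := y :- (y :- b)) refl y b) (s≤b N))
      (<⇒≱ (proj₁ (close N ℕ.≤-refl)))

  module _ {e} (isEuler : IsEuler e) where
    expPartialSum-1≤e : ∀ n → expPartialSum 1# n ≤ e
    expPartialSum-1≤e = sumBelow-≤-limit (λ k → dividedPower-nonNeg k 0≤1) isEuler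

    -- The first two terms of the series. Together with the bound `large`, this is all that the
    -- scheduling analysis assumes about `q`, which stands for e there.
    2≤e : 1# + 1# ≤ e
    2≤e = subst (_≤ e) (cong₂ _+_ (dividedPower-zero 1#) (trans (+-identityʳ _)
             (*-pos-cancelˡ (fromℕ-pos 1) (trans (dividedPower-suc 1# 0)
               (trans (cong (1# *_) (dividedPower-zero 1#)) (cong (_* 1#) (sym (+-identityʳ 1#))))))))
          (expPartialSum-1≤e 2)

    0≤e : 0# ≤ e
    0≤e = expPartialSum-1≤e 0

    -- Induction on `n`: the series at 1 + n is the Cauchy product of those at 1 and n, whose
    -- partial sums are bounded by e and `e ^ n`.
    expPartialSum-fromℕ≤ : ∀ n N → expPartialSum (fromℕ n) N ≤ e ^ n
    expPartialSum-fromℕ≤ zero zero = 0≤1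
    expPartialSum-fromℕ≤ zero (suc N) = ≤-reflexive (trans (cong₂ _+_ (dividedPower-zero 0#) tail≡0) (+-identityʳ 1#))
      where
      tail≡0 : sumBelow N (dividedPower 0# ∘ suc) ≡ 0#
      tail≡0 = trans (sum-cong-≗ {N} (λ k → trans (cong (_* fromℕ (suc (toℕ k) !) ⁻¹) (zeroˡ _)) (zeroˡ _))) (sum-replicate-zero N)
    expPartialSum-fromℕ≤ (suc n) N = subst (_≤ e ^ suc n)
      (sym (sum-cong-≗ {N} (λ k → dividedPower-+ 1# (fromℕ n) (toℕ k))))
      (≤-trans (sumBelow-convolution N (dividedPower 1#) (dividedPower (fromℕ n))
                 (λ k → dividedPower-nonNeg k 0≤1) (expPartialSum-fromℕ≤ n))
        (subst₂ _≤_ (*-comm _ _) (*-comm _ _)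
          (*-monoˡ-≤ (^-nonNeg n 0≤e) (expPartialSum-1≤e N))))

    -- For n = ln ((1 + ε) / ε) this turns the logarithm into the bound (1 + ε) / ε ≤ e^n on which
    -- the algorithm rests.
    exp-fromℕ≤e^ : ∀ {n y} → IsExp (fromℕ n) y → y ≤ e ^ n
    exp-fromℕ≤e^ {n} = limit-≤ (expPartialSum-fromℕ≤ n)

-- Sums over sets of jobs, covers, and packing of disjoint intervals.

module Packing (em : ExcludedMiddle 0ℓ) (ℝ : CompleteOrderedField) where
  open OrderedField ℝ
  open Sum semiring using (sum)

  -- Membership is decided by excluded middle because the sets in use are cut out by inequalities
  -- between reals.
  sumOver : ∀ {n} → (Fin n → Set) → (Fin n → Carrier) → Carrier
  sumOver P f = sum (λ j → if does (em {P j}) then f j else 0#)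

  sumOver-split : ∀ {n} {P Q R : Fin n → Set} {f} → (∀ j → 0# ≤ f j) → (∀ j → P j → Q j ⊎ R j) →
                  sumOver P f ≤ sumOver Q f + sumOver R f
  sumOver-split {zero} f≥0 P⊆Q∪R = ≤-reflexive (sym (+-identityˡ 0#))
  sumOver-split {suc n} {P} {Q} {R} {f} f≥0 P⊆Q∪R =
    subst (sumOver P f ≤_)
      (solve 4 (λ a b c d → a :+ b :+ (c :+ d) := a :+ c :+ (b :+ d)) refl _ _ _ _)
      (+-mono-≤ first (sumOver-split (f≥0 ∘ suc) (P⊆Q∪R ∘ suc)))
    where
    first : (if does (em {P zero}) then f zero else 0#) ≤
            (if does (em {Q zero}) then f zero else 0#) + (if does (em {R zero}) then f zero else 0#)
    first with em {P zero} | em {Q zero} | em {R zero}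
    ... | yes p | no ¬q | no ¬r = contradiction (P⊆Q∪R zero p) λ { (inj₁ q) → ¬q q ; (inj₂ r) → ¬r r }
    ... | yes p | yes q | yes r = ≤-gap (f≥0 zero) (solve 1 (λ f → f :+ f :- f := f) refl _)
    ... | yes p | yes q | no ¬r = ≤-reflexive (sym (+-identityʳ _))
    ... | yes p | no ¬q | yes r = ≤-reflexive (sym (+-identityˡ _))
    ... | no ¬p | yes q | yes r = +-nonNeg (f≥0 zero) (f≥0 zero)
    ... | no ¬p | yes q | no ¬r = +-nonNeg (f≥0 zero) ≤-refl
    ... | no ¬p | no ¬q | yes r = +-nonNeg ≤-refl (f≥0 zero)
    ... | no ¬p | no ¬q | no ¬r = +-nonNeg ≤-refl ≤-refl

  sumOver-mono : ∀ {n} {P Q : Fin n → Set} {f} → (∀ j → 0# ≤ f j) → (∀ j → P j → Q j) → sumOver P f ≤ sumOver Q f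
  sumOver-mono {zero} f≥0 P⊆Q = ≤-refl
  sumOver-mono {suc n} {P} {Q} f≥0 P⊆Q with em {P zero} | em {Q zero}
  ... | yes p | yes q = +-monoʳ-≤ _ (sumOver-mono (f≥0 ∘ suc) (P⊆Q ∘ suc))
  ... | yes p | no ¬q = contradiction (P⊆Q zero p) ¬q
  ... | no ¬p | yes q = +-mono-≤ (f≥0 zero) (sumOver-mono (f≥0 ∘ suc) (P⊆Q ∘ suc))
  ... | no ¬p | no ¬q = +-monoʳ-≤ _ (sumOver-mono (f≥0 ∘ suc) (P⊆Q ∘ suc))

  sumOver-empty : ∀ {n} {P : Fin n → Set} {f} → (∀ j → ¬ P j) → sumOver P f ≡ 0#
  sumOver-empty {zero} ¬P = refl
  sumOver-empty {suc n} {P} ¬P with em {P zero}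
  ... | yes p = contradiction p (¬P zero)
  ... | no _  = trans (+-identityˡ _) (sumOver-empty (¬P ∘ suc))

  listSum : {A : Set} → (A → Carrier) → List A → Carrier
  listSum g = foldr (λ x s → g x + s) 0#

  listSum-const : ∀ {A : Set} x (ys : List A) → listSum (λ _ → x) ys ≡ fromℕ (length ys) * x
  listSum-const x []       = sym (zeroˡ x)
  listSum-const x (_ ∷ ys) = trans (cong (λ z → x + z) (listSum-const x ys))
    (solve 2 (λ x n → x :+ n :* x := (con (+ 1) :+ n) :* x) refl x (fromℕ (length ys)))

  listSum-*ˡ : ∀ {A : Set} c (g : A → Carrier) xs → listSum (λ x → c * g x) xs ≡ c * listSum g xs
  listSum-*ˡ c g []       = sym (zeroʳ c)
  listSum-*ˡ c g (x ∷ xs) = trans (cong (λ z → c * g x + z) (listSum-*ˡ c g xs)) (sym (distribˡ _ _ _))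

  listSum-mono : ∀ {A : Set} {g h : A → Carrier} {xs} → All (λ x → g x ≤ h x) xs → listSum g xs ≤ listSum h xs
  listSum-mono []       = ≤-refl
  listSum-mono (p ∷ ps) = +-mono-≤ p (listSum-mono ps)

  -- Induction on the cover: indices in the set of `x` are paid for by `g x`; the others form a
  -- smaller `P`, on which the remaining bounds still hold.
  sumOver-cover : ∀ {n} {f} → (∀ j → 0# ≤ f j) → ∀ {A : Set} {P : Fin n → Set} (Q : A → Fin n → Set) {g} xs →
    All (λ x → sumOver (λ j → P j × Q x j) f ≤ g x) xs → (∀ j → P j → Any (λ x → Q x j) xs) →
    sumOver P f ≤ listSum g xs
  sumOver-cover f≥0 Q [] _ cover = ≤-reflexive (sumOver-empty λ j p → case cover j p of λ ())
  sumOver-cover f≥0 {P = P} Q (x ∷ xs) (b ∷ bs) cover =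
    ≤-trans (sumOver-split f≥0 split) (+-mono-≤ b (sumOver-cover f≥0 Q xs
      (All.map (≤-trans (sumOver-mono f≥0 λ { _ ((p , _) , q) → p , q })) bs) λ _ → proj₂))
    where
    split : ∀ j → P j → (P j × Q x j) ⊎ (P j × Any (λ y → Q y j) xs)
    split j p with cover j p
    ... | here q  = inj₁ (p , q)
    ... | there r = inj₂ (p , r)

  -- Used with `b` for the optimum and `c` for the algorithm: the last sum is what the optimum gains
  -- on rejected jobs.
  sum-split : ∀ {n} (b c : Fin n → Bool) {f} → (∀ j → 0# ≤ f j) →
    sum (λ j → if b j then f j else 0#) ≤
    sum (λ j → if c j then f j else 0#) + sumOver (λ j → b j ≡ true × c j ≡ false) f
  sum-split {zero} b c f≥0 = ≤-reflexive (sym (+-identityˡ 0#))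
  sum-split {suc n} b c {f} f≥0 =
    subst (sum (λ j → if b j then f j else 0#) ≤_)
      (solve 4 (λ a b c d → a :+ b :+ (c :+ d) := a :+ c :+ (b :+ d)) refl _ _ _ _)
      (+-mono-≤ first (sum-split (b ∘ suc) (c ∘ suc) (f≥0 ∘ suc)))
    where
    first : (if b zero then f zero else 0#) ≤ (if c zero then f zero else 0#) +
            (if does (em {b zero ≡ true × c zero ≡ false}) then f zero else 0#)
    first with b zero | c zero | em {b zero ≡ true × c zero ≡ false}
    ... | false | false | yes _ = +-nonNeg ≤-refl (f≥0 zero)
    ... | false | false | no _  = +-nonNeg ≤-refl ≤-refl
    ... | false | true  | yes _ = +-nonNeg (f≥0 zero) (f≥0 zero)
    ... | false | true  | no _  = +-nonNeg (f≥0 zero) ≤-refl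
    ... | true  | false | yes _ = ≤-reflexive (sym (+-identityˡ _))
    ... | true  | false | no ¬p = contradiction (refl , refl) ¬p
    ... | true  | true  | yes _ = ≤-gap (f≥0 zero) (solve 1 (λ f → f :+ f :- f := f) refl _)
    ... | true  | true  | no _  = ≤-reflexive (sym (+-identityʳ _))

  -- Induction on the index set, without sorting: the first interval cuts the window in two, and
  -- every other interval lies wholly on one side.
  sumOver-packing : ∀ {n} {P : Fin n → Set} (s p : Fin n → Carrier) → (∀ j → 0# ≤ p j) →
    (∀ {i j} → i ≢ j → P i → P j → s i + p i ≤ s j ⊎ s j + p j ≤ s i) →
    ∀ {a b} → a ≤ b → (∀ j → P j → a ≤ s j × s j + p j ≤ b) →
    sumOver P p ≤ b - a
  sumOver-packing {zero} s p p≥0 disjoint a≤b inside = gap a≤b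
  sumOver-packing {suc n} {P} s p p≥0 disjoint {a} {b} a≤b inside with em {P zero}
  ... | no _   = subst (_≤ b - a) (sym (+-identityˡ _))
    (sumOver-packing (s ∘ suc) (p ∘ suc) (p≥0 ∘ suc) (λ i≢j → disjoint (i≢j ∘ Fin.suc-injective))
      a≤b (inside ∘ suc))
  ... | yes P₀ = ≤-trans (+-monoʳ-≤ (p zero) (≤-trans (sumOver-split (p≥0 ∘ suc) split) (+-mono-≤ left right)))
    (≤-reflexive (solve 4 (λ p s a b → p :+ (s :- a :+ (b :- (s :+ p))) := b :- a) refl (p zero) (s zero) a b))
    where
    Before After : Fin n → Set
    Before j = P (suc j) × s (suc j) + p (suc j) ≤ s zero
    After  j = P (suc j) × s zero + p zero ≤ s (suc j)

    split : ∀ j → P (suc j) → Before j ⊎ After j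
    split j Pⱼ with disjoint {zero} {suc j} (λ ()) P₀ Pⱼ
    ... | inj₁ after  = inj₂ (Pⱼ , after)
    ... | inj₂ before = inj₁ (Pⱼ , before)

    left : sumOver Before (p ∘ suc) ≤ s zero - a
    left = sumOver-packing (s ∘ suc) (p ∘ suc) (p≥0 ∘ suc)
      (λ i≢j (Pᵢ , _) (Pⱼ , _) → disjoint (i≢j ∘ Fin.suc-injective) Pᵢ Pⱼ)
      (proj₁ (inside zero P₀)) (λ j (Pⱼ , before) → proj₁ (inside (suc j) Pⱼ) , before)

    right : sumOver After (p ∘ suc) ≤ b - (s zero + p zero)
    right = sumOver-packing (s ∘ suc) (p ∘ suc) (p≥0 ∘ suc)
      (λ i≢j (Pᵢ , _) (Pⱼ , _) → disjoint (i≢j ∘ Fin.suc-injective) Pᵢ Pⱼ)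
      (proj₂ (inside zero P₀)) (λ j (Pⱼ , after) → after , proj₂ (inside (suc j) Pⱼ))

-- The algorithm.

module GroupedFirstFit (em : ExcludedMiddle 0ℓ) (ℝ : CompleteOrderedField)
                       (m : ℕ) (q : CompleteOrderedField.Carrier ℝ) where
  open OrderedField ℝ
  open Scheduling em ℝ
  open Packing em ℝ

  -- A machine together with the time at which its last job completes.
  Entry : Set
  Entry = Fin m × Carrier

  Period : Set
  Period = Carrier × Carrier

  -- A group lists its machines with the most recently used one first.  The
  -- periods are bookkeeping for the analysis: the start of each busy period
  -- and the processing time accepted in it, most recent period first.
  record Group : Set where
    constructor group
    field
      machines : List Entry
      current  : Period
      past     : List Period

    periods : List Period
    periods = current ∷ past

  open Group public

  residual : Carrier → Carrier → Carrier
  residual t c = (t ⊔ c) - t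

  backlog : Carrier → List Entry → Carrier
  backlog t = listSum (λ e → residual t (proj₂ e))

  Fits : Job → Entry → Set
  Fits x (_ , c) = (release x ⊔ c) + processing x ≤ deadline x

  -- A derivation retains the failure at each machine passed over, from which `Balanced-placed`
  -- draws its estimate.
  data FirstFit (x : Job) : List Entry → Entry → List Entry → Set where
    here  : ∀ {e es} → Fits x e → FirstFit x (e ∷ es) e es
    there : ∀ {e es f fs} → ¬ Fits x e → FirstFit x es f fs → FirstFit x (e ∷ es) f (e ∷ fs)

  firstFit : ∀ x es → (∃₂ λ e fs → FirstFit x es e fs) ⊎ All (¬_ ∘ Fits x) es
  firstFit x [] = inj₂ []
  firstFit x (e ∷ es) with em {Fits x e}
  ... | yes fits = inj₁ (e , es , here fits)
  ... | no ¬fits with firstFit x es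
  ...   | inj₁ (f , fs , first) = inj₁ (f , e ∷ fs , there ¬fits first)
  ...   | inj₂ none             = inj₂ (¬fits ∷ none)

  Admissible : Job → Group → Set
  Admissible x G = q * backlog (release x) (machines G) ≤ deadline x - release x

  -- The chosen machine moves to the front in both branches, which keeps the list ordered by
  -- recency; the branches differ only in the bookkeeping of periods.
  assign : Job → Group → Entry → List Entry → Group
  assign x G (k , c) fs with em {backlog (release x) (machines G) ≤ 0#}
  ... | yes idle = group ((k , (release x ⊔ c) + processing x) ∷ fs) (release x , processing x) (periods G)
  ... | no busy  = group ((k , (release x ⊔ c) + processing x) ∷ fs)
                     (proj₁ (current G) , proj₂ (current G) + processing x) (past G)

  -- The graph of `offer`, so that properties of a step follow by induction on derivations.
  data Offer (x : Job) : List Group → List Group → Maybe Entry → Set where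
    rejected : Offer x [] [] nothing
    placed   : ∀ {G Gs k c fs} → Admissible x G → FirstFit x (machines G) (k , c) fs →
               Offer x (G ∷ Gs) (assign x G (k , c) fs ∷ Gs) (just (k , release x ⊔ c))
    passed   : ∀ {G Gs Gs′ o} → ¬ Admissible x G ⊎ All (¬_ ∘ Fits x) (machines G) →
               Offer x Gs Gs′ o → Offer x (G ∷ Gs) (G ∷ Gs′) o

  offer : ∀ x Gs → ∃₂ (Offer x Gs)
  offer x [] = [] , nothing , rejected
  offer x (G ∷ Gs) with em {Admissible x G} | firstFit x (machines G) | offer x Gs
  ... | no ¬adm | _                            | Gs′ , o , step = G ∷ Gs′ , o , passed (inj₁ ¬adm) step
  ... | yes adm | inj₂ none                    | Gs′ , o , step = G ∷ Gs′ , o , passed (inj₂ none) step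
  ... | yes adm | inj₁ ((k , c) , fs , first)  | _ =
    assign x G (k , c) fs ∷ Gs , just (k , release x ⊔ c) , placed adm first

  next : List Group → Job → List Group
  next Gs x = proj₁ (offer x Gs)

  -- The state is recovered by replaying the history. Since `foldl` consumes the first job first,
  -- the run on `x ∷ J` from `Gs` continues by computation as the run on `J` from `next Gs x`.
  policy : List Group → Policy m
  policy Gs H x = proj₁ (proj₂ (offer x (foldl next Gs H)))

  offered : ∀ x Gs → Offer x Gs (next Gs x) (policy Gs [] x)
  offered x Gs = proj₂ (proj₂ (offer x Gs))

  -- Feasibility of the schedules produced.

  entries : List Group → List Entry
  entries Gs = concat (map machines Gs)

  labels : List Group → List (Fin m)
  labels Gs = map proj₁ (entries Gs)

  machines-assign : ∀ x G k c fs → machines (assign x G (k , c) fs) ≡ (k , (release x ⊔ c) + processing x) ∷ fs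
  machines-assign x G k c fs with em {backlog (release x) (machines G) ≤ 0#}
  ... | yes _ = refl
  ... | no _  = refl

  FirstFit⇒↭ : ∀ {x es e fs} → FirstFit x es e fs → es ↭ e ∷ fs
  FirstFit⇒↭ (here _)        = ↭-refl
  FirstFit⇒↭ (there _ first) = ↭-trans (↭-prep _ (FirstFit⇒↭ first)) (↭-swap _ _ ↭-refl)

  FirstFit⇒Fits : ∀ {x es e fs} → FirstFit x es e fs → Fits x e
  FirstFit⇒Fits (here fits)     = fits
  FirstFit⇒Fits (there _ first) = FirstFit⇒Fits first

  -- A placement with the grouping forgotten: up to permutation, one completion time changes.
  record Replaced (x : Job) (es es′ : List Entry) (k : Fin m) (s : Carrier) : Set where
    field
      c      : Carrier
      others : List Entry
      start  : s ≡ release x ⊔ c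
      fits   : Fits x (k , c)
      before : es ↭ (k , c) ∷ others
      after  : es′ ↭ (k , s + processing x) ∷ others

  Offer⇒Replaced : ∀ {x Gs Gs′ k s} → Offer x Gs Gs′ (just (k , s)) → Replaced x (entries Gs) (entries Gs′) k s
  Offer⇒Replaced {x} (placed {G} {Gs} {k} {c} {fs} _ first) = record
    { c = c ; others = fs ++ entries Gs ; start = refl ; fits = FirstFit⇒Fits first
    ; before = ↭.++⁺ʳ (entries Gs) (FirstFit⇒↭ first)
    ; after = subst (λ es → es ++ entries Gs ↭ _) (sym (machines-assign x G k c fs)) ↭-refl }
  Offer⇒Replaced (passed {G} _ step) with Offer⇒Replaced step
  ... | record { c = c ; others = es ; start = start ; fits = fits ; before = before ; after = after } = record
    { c = c ; others = machines G ++ es ; start = start ; fits = fits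
    ; before = ↭-trans (↭.++⁺ˡ (machines G) before) (↭.shift _ (machines G) es)
    ; after  = ↭-trans (↭.++⁺ˡ (machines G) after) (↭.shift _ (machines G) es) }

  Offer-nothing : ∀ {x Gs Gs′} → Offer x Gs Gs′ nothing → Gs ≡ Gs′
  Offer-nothing rejected        = refl
  Offer-nothing (passed _ step) = cong (_ ∷_) (Offer-nothing step)

  Unique-resp-↭ : ∀ {xs ys : List (Fin m)} → xs ↭ ys → Unique xs → Unique ys
  Unique-resp-↭ xs↭ys = ↭ₛ.Unique-resp-↭ (setoid _) (↭⇒↭ₛ xs↭ys)

  Unique-next : ∀ {x Gs Gs′ o} → Offer x Gs Gs′ o → Unique (labels Gs) → Unique (labels Gs′)
  Unique-next {o = nothing} step u = subst (Unique ∘ labels) (Offer-nothing step) u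
  Unique-next {o = just _} step u = Unique-resp-↭ (↭-sym (↭.map⁺ proj₁ after)) (Unique-resp-↭ (↭.map⁺ proj₁ before) u)
    where open Replaced (Offer⇒Replaced step)

  -- Held by all entries, this keeps every later job on machine `k` from starting before `b`.
  FreeFrom : Fin m → Carrier → Entry → Set
  FreeFrom k b (k′ , c) = k ≡ k′ → b ≤ c

  -- Completion times never decrease.
  FreeFrom-next : ∀ {x Gs Gs′ o k b} → 0# ≤ processing x → Offer x Gs Gs′ o →
                  All (FreeFrom k b) (entries Gs) → All (FreeFrom k b) (entries Gs′)
  FreeFrom-next {o = nothing} p≥0 step free = subst (All _ ∘ entries) (Offer-nothing step) free
  FreeFrom-next {x} {o = just (k′ , s)} {k} {b} p≥0 step free
    with record { c = c ; start = start ; before = before ; after = after } ← Offer⇒Replaced step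
    with b≤c ∷ rest ← ↭.All-resp-↭ before free =
    ↭.All-resp-↭ (↭-sym after) ((λ eq → ≤-trans (b≤c eq) (≤-trans c≤s s≤s+p)) ∷ rest)
    where
    c≤s : c ≤ s
    c≤s = subst (c ≤_) (sym start) (x≤y⊔x (release x) c)
    s≤s+p : s ≤ s + processing x
    s≤s+p = ≤-gap p≥0 (solve 2 (λ s p → s :+ p :- s := p) refl s (processing x))

  FreeFrom-run : ∀ J {Gs k b} → (∀ j → 0# ≤ processing (lookup J j)) → All (FreeFrom k b) (entries Gs) →
                 ∀ j {s} → run (policy Gs) J j ≡ just (k , s) → b ≤ s
  FreeFrom-run (x ∷ J) {Gs} {k} {b} p≥0 free zero {s} eq
    with record { c = c ; start = start ; before = before } ← Offer⇒Replaced (subst (Offer x Gs _) eq (offered x Gs))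
    with b≤c ∷ _ ← ↭.All-resp-↭ before free =
    ≤-trans (b≤c refl) (subst (c ≤_) (sym start) (x≤y⊔x (release x) c))
  FreeFrom-run (x ∷ J) {Gs} p≥0 free (suc j) eq =
    FreeFrom-run J (p≥0 ∘ suc) (FreeFrom-next (p≥0 zero) (offered x Gs) free) j eq

  -- Labels are distinct, so after job `i` the only entry for `k` carries its completion time;
  -- `FreeFrom` then persists until job `j`.
  run-ordered : ∀ J {Gs} → (∀ j → 0# ≤ processing (lookup J j)) → Unique (labels Gs) →
                ∀ {i j k s t} → i Fin.< j → run (policy Gs) J i ≡ just (k , s) → run (policy Gs) J j ≡ just (k , t) →
                s + processing (lookup J i) ≤ t
  run-ordered (x ∷ J) {Gs} p≥0 u {zero} {suc j} {k} {s} i<j eqᵢ eqⱼ =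
    FreeFrom-run J (p≥0 ∘ suc) free j eqⱼ
    where
    open Replaced (Offer⇒Replaced (subst (Offer x Gs _) eqᵢ (offered x Gs)))
    free : All (FreeFrom k (s + processing x)) (entries (next Gs x))
    free with k∉ ∷ _ ← Unique-resp-↭ (↭.map⁺ proj₁ before) u =
      ↭.All-resp-↭ (↭-sym after) ((λ _ → ≤-refl) ∷ All.map (λ k≢ k≡ → contradiction k≡ k≢) (All.map⁻ k∉))
  run-ordered (x ∷ J) {Gs} p≥0 u {suc i} {suc j} i<j eqᵢ eqⱼ =
    run-ordered J (p≥0 ∘ suc) (Unique-next (offered x Gs) u) (ℕ.s<s⁻¹ i<j) eqᵢ eqⱼ

  run-feasible : ∀ {ε Gs} → Unique (labels Gs) → ∀ J → IsInstance ε J → Feasible J (run (policy Gs) J)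
  run-feasible {Gs = Gs} u J I = record { inWindow = λ {j} → window {j} ; disjoint = disjoint }
    where
    p≥0 : ∀ j → 0# ≤ processing (lookup J j)
    p≥0 j = proj₁ (IsInstance.processing>0 I j)
    window : ∀ {j k s} → run (policy Gs) J j ≡ just (k , s) →
             release (lookup J j) ≤ s × s + processing (lookup J j) ≤ deadline (lookup J j)
    window {j} {k} {s} eq
      with record { c = c ; start = refl ; fits = fits } ← Offer⇒Replaced
             (subst (Offer (lookup J j) _ _) eq (offered (lookup J j) (foldl next Gs (take (toℕ j) J)))) =
      x≤x⊔y (release (lookup J j)) c , fits
    disjoint : ∀ {i j k s t} → i ≢ j → run (policy Gs) J i ≡ just (k , s) → run (policy Gs) J j ≡ just (k , t) →
               s + processing (lookup J i) ≤ t ⊎ t + processing (lookup J j) ≤ s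
    disjoint {i} {j} i≢j eqᵢ eqⱼ with Fin.<-cmp i j
    ... | tri< i<j _ _ = inj₁ (run-ordered J p≥0 u i<j eqᵢ eqⱼ)
    ... | tri≈ _ i≡j _ = contradiction i≡j i≢j
    ... | tri> _ _ j<i = inj₂ (run-ordered J p≥0 u j<i eqⱼ eqᵢ)

-- Competitive analysis: residual loads and the balance of a group.

module Competitiveness (em : ExcludedMiddle 0ℓ) (ℝ : CompleteOrderedField) where
  open OrderedField ℝ
  open Scheduling em ℝ
  open Packing em ℝ

  module Invariants (m n : ℕ) (q ε : Carrier)
                    (2≤q : 1# + 1# ≤ q) (ε>0 : 0# < ε) (large : 1# + ε ≤ ε * q ^ n) where
    open GroupedFirstFit em ℝ m q
    open Mult semiring using (×1-homo-*)

    private variable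
      t t′ S S′ a a′ N : Carrier
      x y              : Job
      G                : Group
      Gs Gs′           : List Group
      o                : Maybe Entry

    residual-nonNeg : ∀ t c → 0# ≤ residual t c
    residual-nonNeg t c = gap (x≤x⊔y t c)

    -- A machine is either done by `t′` or busy throughout, in which case its load falls by exactly
    -- the elapsed time.
    residual-shift : ∀ c → t ≤ t′ →
      (residual t′ c ≡ 0# × residual t c ≤ t′ - t) ⊎ residual t c ≡ residual t′ c + (t′ - t)
    residual-shift {t} {t′} c t≤t′ = by-cases (total t′ c)
      where
      by-cases : t′ ≤ c ⊎ c ≤ t′ →
        (residual t′ c ≡ 0# × residual t c ≤ t′ - t) ⊎ residual t c ≡ residual t′ c + (t′ - t)
      by-cases (inj₁ t′≤c) = inj₂ (begin
        (t ⊔ c) - t               ≡⟨ cong (_- t) (x≤y⇒x⊔y≈y (≤-trans t≤t′ t′≤c)) ⟩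
        c - t                     ≡⟨ solve 3 (λ c t u → c :- t := c :- u :+ (u :- t)) refl c t t′ ⟩
        (c - t′) + (t′ - t)       ≡⟨ cong (λ z → (z - t′) + (t′ - t)) (x≤y⇒x⊔y≈y t′≤c) ⟨
        (t′ ⊔ c) - t′ + (t′ - t)  ∎)
        where open ≡-Reasoning
      by-cases (inj₂ c≤t′) = inj₁
        ( trans (cong (_- t′) (x≤y⇒y⊔x≈y c≤t′)) (-‿inverseʳ t′)
        , +-monoˡ-≤ (- t) (⊔-lub t≤t′ c≤t′) )

    residual-antitone : ∀ c → t ≤ t′ → residual t′ c ≤ residual t c
    residual-antitone {t} {t′} c t≤t′ with residual-shift c t≤t′
    ... | inj₁ (≡0 , _) = subst (_≤ residual t c) (sym ≡0) (residual-nonNeg t c)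
    ... | inj₂ eq         = ≤-gap (gap t≤t′) (trans (cong (_- residual t′ c) eq)
            (solve 2 (λ r d → r :+ d :- r := d) refl (residual t′ c) (t′ - t)))

    residual-lipschitz : ∀ c → t ≤ t′ → residual t c ≤ residual t′ c + (t′ - t)
    residual-lipschitz {t} {t′} c t≤t′ with residual-shift c t≤t′
    ... | inj₁ (_ , r≤δ) = ≤-trans r≤δ (≤-gap (residual-nonNeg t′ c) (solve 2 (λ r d → r :+ d :- d := r) refl _ _))
    ... | inj₂ eq        = ≤-reflexive eq

    backlog-nonNeg : ∀ t es → 0# ≤ backlog t es
    backlog-nonNeg t []             = ≤-refl
    backlog-nonNeg t ((_ , c) ∷ es) = +-nonNeg (residual-nonNeg t c) (backlog-nonNeg t es)

    backlog-antitone : ∀ es → t ≤ t′ → backlog t′ es ≤ backlog t es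
    backlog-antitone es t≤t′ = listSum-mono {xs = es} (All.universal (λ e → residual-antitone (proj₂ e) t≤t′) es)

    -- A single machine busy up to `t′` already accounts for the drop; without one the backlog has
    -- vanished.
    backlog-shift : ∀ es → t ≤ t′ → backlog t′ es ≤ 0# ⊎ backlog t′ es + (t′ - t) ≤ backlog t es
    backlog-shift [] t≤t′ = inj₁ ≤-refl
    backlog-shift {t} {t′} ((k , c) ∷ es) t≤t′ with residual-shift c t≤t′ | backlog-shift es t≤t′
    ... | inj₂ eq | _ = inj₂ (≤-gap (gap (backlog-antitone es t≤t′))
            (trans (cong (λ r → r + backlog t es - (residual t′ c + backlog t′ es + (t′ - t))) eq)
              (solve 4 (λ r d b b′ → r :+ d :+ b :- (r :+ b′ :+ d) := b :- b′) refl
                (residual t′ c) (t′ - t) (backlog t es) (backlog t′ es))))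
    ... | inj₁ (≡0 , _) | inj₁ idle = inj₁ (subst (λ r → r + backlog t′ es ≤ 0#) (sym ≡0)
            (subst (_≤ 0#) (sym (+-identityˡ _)) idle))
    ... | inj₁ (≡0 , _) | inj₂ b′+δ≤b = inj₂ (≤-gap (+-nonNeg (residual-nonNeg t c) (gap b′+δ≤b))
            (trans (cong (λ r → residual t c + backlog t es - (r + backlog t′ es + (t′ - t))) ≡0)
              (solve 4 (λ r b b′ d → r :+ b :- (con (+ 0) :+ b′ :+ d) := r :+ (b :- (b′ :+ d))) refl
                (residual t c) (backlog t es) (backlog t′ es) (t′ - t))))

    -- S is the residual load of the machines preceding es and a is q to the
    -- power of their number.
    Balanced : Carrier → Carrier → Carrier → List Entry → Set
    Balanced t S a []             = ⊤
    Balanced t S a ((_ , c) ∷ es) = a * residual t c ≤ S + residual t c × Balanced t (S + residual t c) (a * q) es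

    Balanced-mono : ∀ es → S ≤ S′ → Balanced t S a es → Balanced t S′ a es
    Balanced-mono [] _ _ = tt
    Balanced-mono (_ ∷ es) S≤S′ (b , bs) = ≤-trans b (+-monoˡ-≤ _ S≤S′) , Balanced-mono es (+-monoˡ-≤ _ S≤S′) bs

    0≤q : 0# ≤ q
    0≤q = ≤-trans (+-nonNeg 0≤1 0≤1) 2≤q

    -- N counts the machines before es: each of them loses at most t′ - t, which
    -- the growth of the powers of q compensates.
    Balanced-shift : ∀ es → t ≤ t′ → 0# ≤ N → N + 1# ≤ a → 0# ≤ S′ → S ≤ S′ + N * (t′ - t) →
                     Balanced t S a es → Balanced t′ S′ a es
    Balanced-shift [] _ _ _ _ _ _ = tt
    Balanced-shift {t} {t′} {N} {a} {S′} {S} ((_ , c) ∷ es) t≤t′ N≥0 N+1≤a S′≥0 S≤ (b , bs) =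
      first , Balanced-shift es t≤t′ (+-nonNeg N≥0 0≤1)
        -- From q ≥ 2: a q ≥ 2 (N + 1) ≥ N + 2.
        (≤-gap (+-nonNeg (+-nonNeg (*-nonNeg (gap N+1≤a) 0≤q) (*-nonNeg (+-nonNeg N≥0 0≤1) (gap 2≤q))) N≥0)
          (solve 3 (λ a q n → a :* q :- (n :+ con (+ 1) :+ con (+ 1)) :=
             (a :- (n :+ con (+ 1))) :* q :+ (n :+ con (+ 1)) :* (q :- (con (+ 1) :+ con (+ 1))) :+ n)
             refl a q N))
        (+-nonNeg S′≥0 (residual-nonNeg t′ c))
        (≤-gap (+-nonNeg (gap S≤) (gap (residual-lipschitz c t≤t′)))
          (solve 6 (λ s s′ r r′ n d → s′ :+ r′ :+ (n :+ con (+ 1)) :* d :- (s :+ r) :=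
             s′ :+ n :* d :- s :+ (r′ :+ d :- r)) refl S S′ (residual t c) (residual t′ c) N (t′ - t)))
        bs
      where
      first : a * residual t′ c ≤ S′ + residual t′ c
      first with residual-shift c t≤t′
      ... | inj₁ (≡0 , _) = subst (λ r → a * r ≤ S′ + r) (sym ≡0)
              (≤-gap S′≥0 (solve 2 (λ s a → s :+ con (+ 0) :- a :* con (+ 0) := s) refl S′ a))
      ... | inj₂ eq = ≤-gap
              (+-nonNeg (+-nonNeg (gap (subst (λ r → a * r ≤ S + r) eq b)) (gap S≤)) (*-nonNeg (gap N+1≤a) (gap t≤t′)))
              (solve 6 (λ a r s s′ n d → s′ :+ r :- a :* r :=
                 s :+ (r :+ d) :- a :* (r :+ d) :+ (s′ :+ n :* d :- s) :+ (a :- (n :+ con (+ 1))) :* d)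
                 refl a (residual t′ c) S S′ N (t′ - t))

    module _ (x : Job) (p≥0 : 0# ≤ processing x) where
      private
        r p d : Carrier
        r = release x
        p = processing x
        d = deadline x

      residual-completion : ∀ c → residual r ((r ⊔ c) + p) ≡ residual r c + p
      residual-completion c = trans
        (cong (_- r) (x≤y⇒x⊔y≈y (≤-trans (x≤x⊔y r c) (≤-gap p≥0 (solve 2 (λ s p → s :+ p :- s := p) refl (r ⊔ c) p)))))
        (solve 3 (λ s p r → s :+ p :- r := s :- r :+ p) refl (r ⊔ c) p r)

      -- The new job did not fit behind any machine that it overtakes in the
      -- list, so it is long compared with the backlog up to that machine.
      Balanced-placed : ∀ {es k c fs} → FirstFit x es (k , c) fs → 0# ≤ S → q * (S + backlog r es) ≤ d - r →
        residual r c + p + S ≤ S′ → q * a ≡ a′ → Balanced r S a es → Balanced r S′ a′ fs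
      Balanced-placed {S} {S′} {a} {a′} {c = c} {fs} (here _) S≥0 adm S≤ refl (_ , bs) =
        -- Machines behind the chosen one keep their positions, hence their powers of `q`.
        subst (λ a → Balanced r S′ a fs) (*-comm a q) (Balanced-mono fs
          (≤-gap (+-nonNeg (gap S≤) p≥0)
            (solve 4 (λ s s′ v p → s′ :- (s :+ v) := s′ :- (v :+ p :+ s) :+ p) refl S S′ (residual r c) p)) bs)
      Balanced-placed {S} {S′} {a} {c = c} (there {e = _ , y} {es = es} ¬fits first) S≥0 adm S≤ refl (b , bs) =
        -- With ρ the residual load of the overtaken machine: q a ρ ≤ q (S + ρ) ≤ d - r ≤ ρ + p ≤ S′
        -- + ρ.
        ≤-gap
          (+-nonNeg (+-nonNeg (+-nonNeg (+-nonNeg (+-nonNeg (+-nonNeg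
            (gap S≤) (residual-nonNeg r c)) (gap (≰⇒≥ ¬fits))) (gap adm)) (*-nonNeg 0≤q (backlog-nonNeg r es))) S≥0)
            (*-nonNeg 0≤q (gap b)))
          (solve 10 (λ s s′ a q ry r d p v bl →
             s′ :+ (ry :- r) :- q :* a :* (ry :- r) :=
             s′ :- (v :+ p :+ s) :+ v :+ (ry :+ p :- d) :+ (d :- r :- q :* (s :+ (ry :- r :+ bl))) :+ q :* bl :+ s
               :+ q :* (s :+ (ry :- r) :- a :* (ry :- r)))
             refl S S′ a q (r ⊔ y) r d p (residual r c) (backlog r es)) ,
        Balanced-placed first (+-nonNeg S≥0 (residual-nonNeg r y))
          (subst (λ z → q * z ≤ d - r) (sym (+-assoc _ _ _)) adm)
          (≤-gap (gap S≤) (solve 4 (λ s s′ v z → s′ :+ z :- (v :+ (s :+ z)) := s′ :- (v :+ s)) refl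
            S S′ (residual r c + p) (residual r y)))
          (sym (*-assoc q a q)) bs

      backlog-FirstFit : ∀ {es k c fs} → FirstFit x es (k , c) fs → backlog r es ≡ residual r c + backlog r fs
      backlog-FirstFit (here _) = refl
      backlog-FirstFit {c = c} (there {e = e} {fs = fs} _ first) =
        trans (cong (λ z → residual r (proj₂ e) + z) (backlog-FirstFit first))
          (solve 3 (λ a b c → a :+ (b :+ c) := b :+ (a :+ c)) refl _ _ _)

      module _ (slack : (1# + ε) * p ≤ d - r) where
        -- Only the last machine matters: its residual load is so small a part of
        -- the backlog that the job fits there.
        some-fits : ∀ e es → 1# + ε ≤ ε * (a * q ^ length (e ∷ es)) →
          q * (S + backlog r (e ∷ es)) ≤ d - r → Balanced r S a (e ∷ es) → ¬ All (¬_ ∘ Fits x) (e ∷ es)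
        some-fits {a} {S} (_ , c) [] large adm (b , _) (¬fits ∷ []) = ¬fits
          -- With ρ the residual load: (1 + ε) ρ ≤ ε a q ρ ≤ ε q (S + ρ) ≤ ε (d - r). Adding the
          -- slack condition gives (1 + ε) (ρ + p) ≤ (1 + ε) (d - r).
          (*-pos-cancelˡ-≤ (pos+nonNeg (0≤1 , 0≢1) (proj₁ ε>0)) (≤-gap
            (+-nonNeg (+-nonNeg (+-nonNeg (gap slack) (*-nonNeg (proj₁ ε>0) (gap adm)))
              (*-nonNeg (*-nonNeg (proj₁ ε>0) 0≤q) (gap b))) (*-nonNeg (gap large) (residual-nonNeg r c)))
            (solve 8 (λ e a q s p r d rc →
               (con (+ 1) :+ e) :* d :- (con (+ 1) :+ e) :* (rc :+ p) :=
               d :- r :- (con (+ 1) :+ e) :* p :+ e :* (d :- r :- q :* (s :+ (rc :- r :+ con (+ 0))))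
                 :+ e :* q :* (s :+ (rc :- r) :- a :* (rc :- r))
                 :+ (e :* (a :* (q :* con (+ 1))) :- (con (+ 1) :+ e)) :* (rc :- r))
               refl ε a q S p r d (r ⊔ c))))
        some-fits {a} {S} (_ , c) (e ∷ es) large adm (_ , bs) (_ ∷ ¬fits) = some-fits e es
          (subst (λ z → 1# + ε ≤ ε * z) (sym (*-assoc a q _)) large)
          (subst (λ z → q * z ≤ d - r) (sym (+-assoc _ _ _)) adm) bs ¬fits

    -- Arrivals of jobs and the invariant of a group.

    record Arrives (t : Carrier) (x : Job) : Set where
      field
        later : t ≤ release x
        p≥0   : 0# ≤ processing x
        slack : (1# + ε) * processing x ≤ deadline x - release x

    open Arrives

    -- An instance in a form suited to induction: each release date is a lower bound for the next.
    data Arriving : Carrier → List Job → Set where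
      []  : Arriving t []
      _∷_ : ∀ {J} → Arrives t x → Arriving (release x) J → Arriving t (x ∷ J)

    IsInstance-tail : ∀ {J} → IsInstance ε (x ∷ J) → IsInstance ε J
    IsInstance-tail I = record
      { release≥0 = release≥0 ∘ suc ; processing>0 = processing>0 ∘ suc ; slack = IsInstance.slack I ∘ suc
      ; ordered = λ i j rᵢ<rⱼ → ℕ.s<s⁻¹ (ordered (suc i) (suc j) rᵢ<rⱼ) }
      where open IsInstance I using (release≥0; processing>0; ordered)

    IsInstance⇒Arriving : ∀ J → (∀ j → t ≤ release (lookup J j)) → IsInstance ε J → Arriving t J
    IsInstance⇒Arriving [] _ _ = []
    IsInstance⇒Arriving {t} (x ∷ J) t≤ I =
      record { later = t≤ zero ; p≥0 = proj₁ (processing>0 zero) ; slack = IsInstance.slack I zero }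
      ∷ IsInstance⇒Arriving J x≤ (IsInstance-tail I)
      where
      open IsInstance I using (processing>0; ordered)
      x≤ : ∀ j → release x ≤ release (lookup J j)
      x≤ j with em {release x ≤ release (lookup J j)}
      ... | yes p = p
      ... | no ¬p = contradiction (ordered (suc j) zero (≰⇒> ¬p)) λ ()

    -- The potential t + q U in `covers` bounds the deadline of any job inadmissible at time t,
    -- which satisfies d < t + q U.
    record Invariant (t : Carrier) (G : Group) : Set where
      field
        size     : length (machines G) ≡ n
        balanced : Balanced t 0# 1# (machines G)
        begun    : proj₁ (current G) ≤ t
        covers   : backlog t (machines G) ≤ 0# ⊎
                   t + q * backlog t (machines G) ≤ proj₁ (current G) + q * proj₂ (current G)
        works    : All (λ π → 0# ≤ proj₂ π) (periods G)

    open Invariant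

    Invariant-shift : t ≤ t′ → Invariant t G → Invariant t′ G
    Invariant-shift {t} {t′} {G} t≤t′ inv = record
      { size     = size inv
      ; balanced = Balanced-shift (machines G) t≤t′ ≤-refl (≤-reflexive (+-identityˡ 1#)) ≤-refl
          (≤-reflexive (solve 1 (λ d → con (+ 0) := con (+ 0) :+ con (+ 0) :* d) refl (t′ - t))) (balanced inv)
      ; begun    = ≤-trans (begun inv) t≤t′
      ; covers   = still-covers (backlog-shift (machines G) t≤t′) (covers inv)
      ; works    = works inv }
      where
      U U′ e : Carrier
      U  = backlog t (machines G)
      U′ = backlog t′ (machines G)
      e  = proj₁ (current G) + q * proj₂ (current G)
      still-covers : U′ ≤ 0# ⊎ U′ + (t′ - t) ≤ U → U ≤ 0# ⊎ t + q * U ≤ e → U′ ≤ 0# ⊎ t′ + q * U′ ≤ e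
      still-covers (inj₁ idle) _ = inj₁ idle
      still-covers (inj₂ _) (inj₁ idle) = inj₁ (≤-trans (backlog-antitone (machines G) t≤t′) idle)
      -- The elapsed time is added once to t but taken at least q times from q U, so the potential
      -- does not rise.
      still-covers (inj₂ U′+δ≤U) (inj₂ t+qU≤e) = inj₂ (≤-gap
        (+-nonNeg (+-nonNeg (+-nonNeg (gap t+qU≤e) (*-nonNeg 0≤q (gap U′+δ≤U)))
          (*-nonNeg (gap 2≤q) (gap t≤t′))) (gap t≤t′))
        (solve 6 (λ t u q b b′ e → e :- (u :+ q :* b′) :=
            e :- (t :+ q :* b) :+ q :* (b :- (b′ :+ (u :- t))) :+ (q :- (con (+ 1) :+ con (+ 1))) :* (u :- t) :+ (u :- t))
          refl t t′ q U U′ e))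

    length-FirstFit : ∀ {es e fs} → FirstFit x es e fs → length es ≡ suc (length fs)
    length-FirstFit (here _)        = refl
    length-FirstFit (there _ first) = cong suc (length-FirstFit first)

    completed : Job → Entry → Entry
    completed x (k , c) = k , (release x ⊔ c) + processing x

    Balanced-completed : ∀ {es e fs} → 0# ≤ processing x → q * backlog (release x) es ≤ deadline x - release x →
      FirstFit x es e fs → Balanced (release x) 0# 1# es → Balanced (release x) 0# 1# (completed x e ∷ fs)
    Balanced-completed {x} {es} {k , c} p≥0 adm first bal =
      ≤-reflexive (trans (*-identityˡ _) (sym (+-identityˡ _))) ,
      Balanced-placed x p≥0 first ≤-refl (subst (λ z → q * z ≤ deadline x - release x) (sym (+-identityˡ _)) adm)
        (≤-reflexive (trans (+-comm _ 0#) (cong (λ z → 0# + z) (sym (residual-completion x p≥0 c)))))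
        (*-comm q 1#) bal

    backlog-completed : ∀ {es e fs} → 0# ≤ processing x → FirstFit x es e fs →
      backlog (release x) (completed x e ∷ fs) ≡ backlog (release x) es + processing x
    backlog-completed {x} {es} {k , c} {fs} p≥0 first = begin
      residual r ((r ⊔ c) + p) + backlog r fs   ≡⟨ cong (_+ backlog r fs) (residual-completion x p≥0 c) ⟩
      residual r c + p + backlog r fs
        ≡⟨ solve 3 (λ a p b → a :+ p :+ b := a :+ b :+ p) refl (residual r c) p (backlog r fs) ⟩
      residual r c + backlog r fs + p           ≡⟨ cong (_+ p) (backlog-FirstFit x p≥0 first) ⟨
      backlog r es + p                          ∎
      where
      open ≡-Reasoning
      r p : Carrier
      r = release x
      p = processing x

    -- In a running period both sides of `covers` grow by q p; a new period starts with backlog and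
    -- work both at most p.
    Invariant-assign : ∀ {e fs} → 0# ≤ processing x → Admissible x G → FirstFit x (machines G) e fs →
                       Invariant (release x) G → Invariant (release x) (assign x G e fs)
    Invariant-assign {x} {G} {e} {fs} p≥0 adm first inv with em {backlog (release x) (machines G) ≤ 0#}
    ... | yes idle = record
      { size     = trans (sym (length-FirstFit first)) (size inv)
      ; balanced = Balanced-completed p≥0 adm first (balanced inv)
      ; begun    = ≤-refl
      ; covers   = inj₂ (subst (λ z → release x + q * z ≤ release x + q * processing x) (sym (backlog-completed p≥0 first))
          (+-monoʳ-≤ _ (*-monoˡ-≤ 0≤q (≤-trans (+-monoˡ-≤ (processing x) idle) (≤-reflexive (+-identityˡ _))))))
      ; works    = p≥0 ∷ works inv }
    ... | no busy = record
      { size     = trans (sym (length-FirstFit first)) (size inv)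
      ; balanced = Balanced-completed p≥0 adm first (balanced inv)
      ; begun    = begun inv
      ; covers   = inj₂ (subst (λ z → release x + q * z ≤ s + q * (B + processing x)) (sym (backlog-completed p≥0 first))
          (still-covers (covers inv)))
      ; works    = +-nonNeg (All.head (works inv)) p≥0 ∷ All.tail (works inv) }
      where
      U s B : Carrier
      U = backlog (release x) (machines G)
      s = proj₁ (current G)
      B = proj₂ (current G)
      still-covers : U ≤ 0# ⊎ release x + q * U ≤ s + q * B → release x + q * (U + processing x) ≤ s + q * (B + processing x)
      still-covers (inj₁ idle) = contradiction idle busy
      still-covers (inj₂ h) = ≤-gap (gap h)
        (solve 6 (λ r q u p s b → s :+ q :* (b :+ p) :- (r :+ q :* (u :+ p)) := s :+ q :* b :- (r :+ q :* u)) refl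
          (release x) q U (processing x) s B)

    -- Windows of refused jobs lie within busy periods stretched by the factor q.

    Contains : Job → Period → Set
    Contains x (s , B) = s ≤ release x × deadline x ≤ s + q * B

    Covered : Job → Group → Set
    Covered x G = Any (Contains x) (periods G)

    Contains-extend : ∀ {s B p} → 0# ≤ p → Contains x (s , B) → Contains x (s , B + p)
    Contains-extend p≥0 (s≤r , d≤) = s≤r , ≤-trans d≤ (+-monoʳ-≤ _ (*-monoˡ-≤ 0≤q
      (≤-gap p≥0 (solve 2 (λ b p → b :+ p :- b := p) refl _ _))))

    Covered-assign : ∀ e fs → 0# ≤ processing x → Covered y G → Covered y (assign x G e fs)
    Covered-assign {x} {y} {G} e fs p≥0 cov with em {backlog (release x) (machines G) ≤ 0#}
    ... | yes idle = there cov
    ... | no busy with cov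
    ...   | here c  = here (Contains-extend {y} p≥0 c)
    ...   | there c = there c

    work : Group → Carrier
    work G = listSum proj₂ (periods G)

    work-assign : ∀ e fs → work (assign x G e fs) ≡ processing x + work G
    work-assign {x} {G} e fs with em {backlog (release x) (machines G) ≤ 0#}
    ... | yes idle = refl
    ... | no busy  = trans (cong (_+ listSum proj₂ (past G)) (+-comm _ _)) (+-assoc _ _ _)

    0≤window : Arrives t x → 0# ≤ deadline x - release x
    0≤window a = ≤-trans (*-nonNeg (+-nonNeg 0≤1 (proj₁ ε>0)) (p≥0 a)) (slack a)

    -- In a balanced group every admissible job fits somewhere, so the job was inadmissible, and
    -- `covers` bounds its deadline.
    refused⇒Covered : Arrives t x → ¬ Admissible x G ⊎ All (¬_ ∘ Fits x) (machines G) →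
                      Invariant (release x) G → Covered x G
    refused⇒Covered {x = x} {G} a refused inv with em {Admissible x G} | refused
    ... | no ¬adm | _         = here (begun inv , within (covers inv))
      where
      within : _ → deadline x ≤ proj₁ (current G) + q * proj₂ (current G)
      -- Without backlog any job with a nonnegative window is admissible.
      within (inj₁ idle) = contradiction (≤-trans (*-monoˡ-≤ 0≤q idle) (≤-trans (≤-reflexive (zeroʳ q)) (0≤window a))) ¬adm
      within (inj₂ h) = ≤-gap (+-nonNeg (gap (≰⇒≥ ¬adm)) (gap h))
        (solve 4 (λ d r qu e → e :- d := qu :- (d :- r) :+ (e :- (r :+ qu))) refl
          (deadline x) (release x) (q * backlog (release x) (machines G)) (proj₁ (current G) + q * proj₂ (current G)))
    ... | yes adm | inj₁ ¬adm = contradiction adm ¬adm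
    ... | yes adm | inj₂ none = contradiction none (impossible (machines G) (size inv) adm (balanced inv))
      where
      impossible : ∀ es → length es ≡ n → q * backlog (release x) es ≤ deadline x - release x →
                   Balanced (release x) 0# 1# es → ¬ All (¬_ ∘ Fits x) es
      -- Here n = 0, and `large` would read 1 + ε ≤ ε.
      impossible [] refl _ _ _ = 0≢1 (≤-antisym 0≤1 (≤-gap (gap large)
        (solve 1 (λ e → con (+ 0) :- con (+ 1) := e :* con (+ 1) :- (con (+ 1) :+ e)) refl ε)))
      impossible (e ∷ es) refl adm bal = some-fits x (p≥0 a) (slack a) e es
        (subst (λ z → 1# + ε ≤ ε * z) (sym (*-identityˡ _)) large)
        (subst (λ z → q * z ≤ deadline x - release x) (sym (+-identityˡ _)) adm) bal

    Invariant-offer : 0# ≤ processing x → Offer x Gs Gs′ o →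
                      All (Invariant (release x)) Gs → All (Invariant (release x)) Gs′
    Invariant-offer p≥0 rejected             invs         = invs
    Invariant-offer p≥0 (placed adm first)   (inv ∷ invs) = Invariant-assign p≥0 adm first inv ∷ invs
    Invariant-offer p≥0 (passed _ step)      (inv ∷ invs) = inv ∷ Invariant-offer p≥0 step invs

    Covered-offer : 0# ≤ processing x → Offer x Gs Gs′ o → All (Covered y) Gs → All (Covered y) Gs′
    Covered-offer p≥0 rejected                 covs         = covs
    Covered-offer {y = y} p≥0 (placed {k = k} {c} {fs} _ _) (cov ∷ covs) = Covered-assign {y = y} (k , c) fs p≥0 cov ∷ covs
    Covered-offer {y = y} p≥0 (passed _ step)          (cov ∷ covs) = cov ∷ Covered-offer {y = y} p≥0 step covs

    rejected⇒Covered : Arrives t x → Offer x Gs Gs′ nothing → All (Invariant (release x)) Gs → All (Covered x) Gs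
    rejected⇒Covered a rejected              _            = []
    rejected⇒Covered a (passed refused step) (inv ∷ invs) = refused⇒Covered a refused inv ∷ rejected⇒Covered a step invs

    length-offer : Offer x Gs Gs′ o → length Gs′ ≡ length Gs
    length-offer rejected        = refl
    length-offer (placed _ _)    = refl
    length-offer (passed _ step) = cong suc (length-offer step)

    work-offer : Offer x Gs Gs′ o → listSum work Gs′ ≡ (if is-just o then processing x else 0#) + listSum work Gs
    work-offer rejected = sym (+-identityˡ _)
    work-offer {x} (placed {G} {Gs} {k} {c} {fs} _ _) =
      trans (cong (_+ listSum work Gs) (work-assign (k , c) fs)) (+-assoc _ _ _)
    work-offer (passed {G} {Gs} _ step) = trans (cong (λ z → work G + z) (work-offer step))
      (solve 3 (λ a b c → a :+ (b :+ c) := b :+ (a :+ c)) refl _ _ _)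

    final : List Group → List Job → List Group
    final = foldl next

    Invariant-final : ∀ {J} → Arriving t J → All (Invariant t) Gs → ∃ λ u → All (Invariant u) (final Gs J)
    Invariant-final []       invs = _ , invs
    Invariant-final {Gs = Gs} (_∷_ {x = x} a as) invs =
      Invariant-final as (Invariant-offer (p≥0 a) (offered x Gs) (All.map (Invariant-shift (later a)) invs))

    Covered-final : ∀ {J} → Arriving t J → All (Covered y) Gs → All (Covered y) (final Gs J)
    Covered-final []       covs = covs
    Covered-final {y = y} {Gs = Gs} (_∷_ {x = x} a as) covs =
      Covered-final {y = y} as (Covered-offer {y = y} (p≥0 a) (offered x Gs) covs)

    length-final : ∀ Gs J → length (final Gs J) ≡ length Gs
    length-final Gs []      = refl
    length-final Gs (x ∷ J) = trans (length-final (next Gs x) J) (length-offer (offered x Gs))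

    -- A rejected job was refused by every group on arrival; the periods covering it then are later
    -- only extended or followed by new ones.
    run-rejected⇒Covered : ∀ {J} → Arriving t J → All (Invariant t) Gs →
      ∀ j → run (policy Gs) J j ≡ nothing → All (Covered (lookup J j)) (final Gs J)
    run-rejected⇒Covered {Gs = Gs} (_∷_ {x = x} a as) invs zero eq =
      Covered-final {y = x} as (Covered-offer {y = x} (p≥0 a) (offered x Gs)
        (rejected⇒Covered a (subst (Offer x Gs _) eq (offered x Gs)) (All.map (Invariant-shift (later a)) invs)))
    run-rejected⇒Covered {Gs = Gs} (_∷_ {x = x} a as) invs (suc j) eq =
      run-rejected⇒Covered as (Invariant-offer (p≥0 a) (offered x Gs) (All.map (Invariant-shift (later a)) invs)) j eq

    -- Each accepted job is booked once, in a period of the group that takes it.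
    work-final : ∀ Gs J → listSum work (final Gs J) ≡ load J (accepted {m} {J} (run (policy Gs) J)) + listSum work Gs
    work-final Gs []      = sym (+-identityˡ _)
    work-final Gs (x ∷ J) = trans (work-final (next Gs x) J) (trans (cong (λ z → rest + z) (work-offer (offered x Gs)))
      (solve 3 (λ a b c → a :+ (b :+ c) := b :+ a :+ c) refl rest _ _))
      where
      rest : Carrier
      rest = load J (accepted {m} {J} (run (policy (next Gs x)) J))

    Arriving⇒p≥0 : ∀ {J} → Arriving t J → ∀ j → 0# ≤ processing (lookup J j)
    Arriving⇒p≥0 (a ∷ _)  zero    = p≥0 a
    Arriving⇒p≥0 (_ ∷ as) (suc j) = Arriving⇒p≥0 as j

    -- Charging the jobs that a feasible schedule completes and the algorithm rejects.

    module _ {J} (as : Arriving t J) (invs : All (Invariant t) Gs) (σ : Schedule m J) (feasible : Feasible J σ) where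
      open Feasible feasible

      private
        ρ : Schedule m J
        ρ = run (policy Gs) J
        p start : Fin (length J) → Carrier
        p j     = processing (lookup J j)
        -- The value `0#` only makes `start` total; `On` holds of scheduled jobs alone.
        start j = maybe′ proj₂ 0# (σ j)

      Missed : Fin (length J) → Set
      Missed j = Vec.lookup (accepted {m} {J} σ) j ≡ true × Vec.lookup (accepted {m} {J} ρ) j ≡ false

      On : Fin m → Fin (length J) → Set
      On k j = σ j ≡ just (k , start j)

      missed⇒scheduled : ∀ j → Missed j → ∃ λ k → On k j
      missed⇒scheduled j (acc , _) with σ j | trans (sym (Vec.lookup∘tabulate (is-just ∘ σ) j)) acc
      ... | just (k , s) | _ = k , refl

      missed⇒rejected : ∀ j → Missed j → ρ j ≡ nothing
      missed⇒rejected j (_ , rej) with ρ j | trans (sym (Vec.lookup∘tabulate (is-just ∘ ρ) j)) rej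
      ... | nothing | _ = refl

      -- On machine `k` these jobs occupy disjoint intervals within their windows, hence within
      -- [s, s + q B].
      missed-in-period : ∀ k π → 0# ≤ proj₂ π →
        sumOver (λ j → (Missed j × On k j) × Contains (lookup J j) π) p ≤ q * proj₂ π
      missed-in-period k (s , B) B≥0 = subst (sumOver P p ≤_) (solve 2 (λ s b → s :+ b :- s := b) refl s (q * B))
        (sumOver-packing start p (Arriving⇒p≥0 as)
          (λ { i≢j ((_ , onᵢ) , _) ((_ , onⱼ) , _) → disjoint i≢j onᵢ onⱼ })
          (≤-gap (*-nonNeg 0≤q B≥0) (solve 2 (λ s b → s :+ b :- s := b) refl s (q * B)))
          (λ { j ((_ , on) , s≤r , d≤) → ≤-trans s≤r (proj₁ (inWindow on)) , ≤-trans (proj₂ (inWindow on)) d≤ }))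
        where
        P : Fin (length J) → Set
        P j = (Missed j × On k j) × Contains (lookup J j) (s , B)

      missed-on-machine : ∀ k → Invariant t′ G → (∀ j → Missed j → Covered (lookup J j) G) →
        sumOver (λ j → Missed j × On k j) p ≤ q * work G
      missed-on-machine {G = G} k inv covered = subst (sumOver (λ j → Missed j × On k j) p ≤_) (listSum-*ˡ q proj₂ (periods G))
        (sumOver-cover (Arriving⇒p≥0 as) (λ π j → Contains (lookup J j) π) (periods G)
          (All.map (λ {π} → missed-in-period k π) (works inv)) λ { j (missed , _) → covered j missed })

      -- One group is charged for all m machines of `σ`; summing over the groups later makes up for
      -- this.
      missed-≤ : Invariant t′ G → (∀ j → Missed j → Covered (lookup J j) G) →
        sumOver Missed p ≤ fromℕ m * q * work G
      missed-≤ {G = G} inv covered = subst (sumOver Missed p ≤_)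
        (trans (listSum-const (q * work G) (allFin m))
          (trans (cong (λ l → fromℕ l * (q * work G)) (List.length-tabulate {n = m} (λ k → k))) (sym (*-assoc _ _ _))))
        (sumOver-cover (Arriving⇒p≥0 as) On (allFin m)
          (All.universal (λ k → missed-on-machine k inv covered) (allFin m))
          λ j missed → let k , on = missed⇒scheduled j missed in Any.map (λ { refl → on }) (∈-allFin k))

      private
        W : Carrier
        W = load J (accepted {m} {J} ρ)

      -- Every group yields a bound on the same missed total, and the works of the groups add up to
      -- the value of the algorithm.
      missed-≤-work : listSum work Gs ≡ 0# → fromℕ (length Gs) * sumOver Missed p ≤ fromℕ m * q * W
      missed-≤-work unused = subst₂ _≤_
        (trans (listSum-const (sumOver Missed p) (final Gs J)) (cong (λ l → fromℕ l * sumOver Missed p) (length-final Gs J)))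
        (trans (listSum-*ˡ (fromℕ m * q) work (final Gs J))
          (cong (λ w → fromℕ m * q * w) (trans (work-final Gs J) (trans (cong (λ z → W + z) unused) (+-identityʳ W)))))
        (listSum-mono {xs = final Gs J} (All.zipWith (λ (inv , covered) → missed-≤ inv covered)
          (proj₂ (Invariant-final as invs) , all-covered)))
        where
        all-covered : All (λ G → ∀ j → Missed j → Covered (lookup J j) G) (final Gs J)
        all-covered = All.tabulate λ G∈ j missed →
          All.lookup (run-rejected⇒Covered as invs j (missed⇒rejected j missed)) G∈

      load-≤ : listSum work Gs ≡ 0# → .{{_ : ℕ.NonZero (length Gs)}} → m ≡ length Gs ℕ.* n →
               load J (accepted {m} {J} σ) ≤ (q * fromℕ n + 1#) * W
      load-≤ unused m≡ = begin
        load J (accepted {m} {J} σ)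
          ≤⟨ sum-split (Vec.lookup (accepted {m} {J} σ)) (Vec.lookup (accepted {m} {J} ρ)) (Arriving⇒p≥0 as) ⟩
        W + sumOver Missed p          ≤⟨ +-monoʳ-≤ W (*-pos-cancelˡ-≤ (fromℕ-pos (length Gs)) scaled) ⟩
        W + fromℕ n * q * W           ≡⟨ solve 3 (λ w n q → w :+ n :* q :* w := (q :* n :+ con (+ 1)) :* w) refl W (fromℕ n) q ⟩
        (q * fromℕ n + 1#) * W        ∎
        where
        open ≤-Reasoning
        scaled : fromℕ (length Gs) * sumOver Missed p ≤ fromℕ (length Gs) * (fromℕ n * q * W)
        scaled = begin
          fromℕ (length Gs) * sumOver Missed p        ≤⟨ missed-≤-work unused ⟩
          fromℕ m * q * W                             ≡⟨ cong (λ z → z * q * W) (trans (cong fromℕ m≡) (×1-homo-* (length Gs) n)) ⟩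
          fromℕ (length Gs) * fromℕ n * q * W
            ≡⟨ solve 4 (λ i n q w → i :* n :* q :* w := i :* (n :* q :* w)) refl (fromℕ (length Gs)) (fromℕ n) q W ⟩
          fromℕ (length Gs) * (fromℕ n * q * W)       ∎

  -- The initial state and the ratio for i groups of n machines.

  module _ (i n : ℕ) .{{_ : ℕ.NonZero i}} (q ε : Carrier)
           (2≤q : 1# + 1# ≤ q) (ε>0 : 0# < ε) (large : 1# + ε ≤ ε * q ^ n) where
    open GroupedFirstFit em ℝ (i ℕ.* n) q
    open Invariants (i ℕ.* n) n q ε 2≤q ε>0 large

    -- `Fin.combine g` enumerates the g-th block of n machines; the initial period is empty and
    -- contributes no work.
    idleGroup : Fin i → Group
    idleGroup g = group (map (λ h → Fin.combine g h , 0#) (allFin n)) (0# , 0#) []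

    idleGroups : List Group
    idleGroups = map idleGroup (allFin i)

    labels-idle : ∀ gs → labels (map idleGroup gs) ≡ cartesianProductWith Fin.combine gs (allFin n)
    labels-idle []       = refl
    labels-idle (g ∷ gs) = trans (List.map-++ proj₁ (machines (idleGroup g)) _)
      (cong₂ _++_ (sym (List.map-∘ (allFin n))) (labels-idle gs))

    Unique-idle : Unique (labels idleGroups)
    Unique-idle = subst Unique (sym (labels-idle (allFin i)))
      (cartesianProductWith⁺ Fin.combine (Fin.combine-injective _ _ _ _) (allFin⁺ i) (allFin⁺ n))

    residual-0 : residual 0# 0# ≡ 0#
    residual-0 = trans (cong (_- 0#) (x≤y⇒x⊔y≈y ≤-refl)) (-‿inverseʳ 0#)

    Balanced-idle : ∀ {a S} (k : Fin n → Fin (i ℕ.* n)) hs → 0# ≤ S → Balanced 0# S a (map (λ h → k h , 0#) hs)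
    Balanced-idle k []       S≥0 = tt
    Balanced-idle {a = a} {S} k (h ∷ hs) S≥0 =
      subst (λ r → a * r ≤ S + r) (sym residual-0) (≤-gap S≥0
        (solve 2 (λ a s → s :+ con (+ 0) :- a :* con (+ 0) := s) refl a S)) ,
      Balanced-idle k hs (+-nonNeg S≥0 (residual-nonNeg 0# 0#))

    backlog-idle : ∀ (k : Fin n → Fin (i ℕ.* n)) hs → backlog 0# (map (λ h → k h , 0#) hs) ≡ 0#
    backlog-idle k []       = refl
    backlog-idle k (h ∷ hs) = trans (cong₂ _+_ residual-0 (backlog-idle k hs)) (+-identityʳ 0#)

    Invariant-idle : ∀ g → Invariant 0# (idleGroup g)
    Invariant-idle g = record
      { size     = trans (List.length-map _ (allFin n)) (List.length-tabulate {n = n} (λ h → h))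
      ; balanced = Balanced-idle (Fin.combine g) (allFin n) ≤-refl
      ; begun    = ≤-refl
      ; covers   = inj₁ (≤-reflexive (backlog-idle (Fin.combine g) (allFin n)))
      ; works    = ≤-refl ∷ [] }

    work-idle : ∀ gs → listSum work (map idleGroup gs) ≡ 0#
    work-idle []       = refl
    work-idle (g ∷ gs) = trans (cong₂ _+_ (+-identityʳ 0#) (work-idle gs)) (+-identityʳ 0#)

    algorithm : OnlineAlgorithm (i ℕ.* n) ε
    algorithm = record { decide = policy idleGroups ; feasible = run-feasible Unique-idle }

    length-idle : length idleGroups ≡ i
    length-idle = trans (List.length-map idleGroup (allFin i)) (List.length-tabulate {n = i} (λ g → g))

    algorithm-competitive : StrictlyCompetitive algorithm (q * fromℕ n + 1#)
    algorithm-competitive J I with optimum (i ℕ.* n) J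
    -- The optimum is attained by a feasible schedule `σ`, to which `load-≤` applies.
    ... | _ , (σ , feasible , refl) , _ =
      load-≤ (IsInstance⇒Arriving J (IsInstance.release≥0 I) I)
        (All.map⁺ (All.universal Invariant-idle (allFin i))) σ feasible (work-idle (allFin i))
        {{subst ℕ.NonZero (sym length-idle) (ℕ.≢-nonZero (ℕ.≢-nonZero⁻¹ i))}}
        (cong (ℕ._* n) (sym length-idle))

-- Specialisation to q = e and n = ln ((1 + ε) / ε).

corollary1 : (em : ExcludedMiddle 0ℓ) (ℝ : CompleteOrderedField) →
    let open CompleteOrderedField ℝ
        open Analysis ℝ
        open Scheduling em ℝ in
    (e : Carrier) → IsEuler e →
    (ε : Carrier) → 0# < ε → ε ≤ 1# →
    (l : Carrier) → IsLn ((1# + ε) / ε) l →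
    (k : ℤ) → l ≡ fromℤ k →
    (m i : ℕ) → 0 ℕ.< i → + m ≡ + i ℤ.* k →
    ∃ λ (A : OnlineAlgorithm m ε) → StrictlyCompetitive A (e * l + 1#)
-- A negative logarithm would make m negative, since i > 0.
corollary1 em ℝ e isEuler ε ε>0 ε≤1 l isLn -[1+ n ] l≡k m (suc i) 0<i ()
corollary1 em ℝ e isEuler ε ε>0 ε≤1 _ isLn (+ n) refl m i@(suc _) 0<i m≡ik
  with refl ← ℤ.+-injective (trans m≡ik (sym (ℤ.pos-* i n))) =
  algorithm i n e ε (2≤e isEuler) ε>0 large , algorithm-competitive i n e ε (2≤e isEuler) ε>0 large
  where
  open OrderedField ℝ
  open Exponential em ℝ
  open Competitiveness em ℝ
  -- The bound (1 + ε) / ε = exp n ≤ e^n, multiplied by ε.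
  large : 1# + ε ≤ ε * e ^ n
  large = begin
    1# + ε                 ≡⟨ *-identityʳ _ ⟨
    (1# + ε) * 1#          ≡⟨ cong ((1# + ε) *_) (*-inverse-pos ε>0) ⟨
    (1# + ε) * (ε * ε ⁻¹)  ≡⟨ solve 3 (λ a b c → a :* (b :* c) := b :* (a :* c)) refl (1# + ε) ε (ε ⁻¹) ⟩
    ε * ((1# + ε) / ε)     ≤⟨ *-monoˡ-≤ (proj₁ ε>0) (exp-fromℕ≤e^ isEuler {n} isLn) ⟩
    ε * e ^ n              ∎
    where open ≤-Reasoning
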